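{- The $\mu$-focused system is sound and complete with respect to $\mu$MALL: if $\vdash\ \Uparrow\Gamma$ is provable in the $\mu$-focused system, then $\vdash\Gamma$ is provable in $\mu$MALL; and if $\vdash\Gamma$ has a quasi-finite $\mu$MALL derivation, then $\vdash\ \Uparrow\Gamma$ has a focused derivation.
   Context: $\mu$MALL is first-order MALL (connectives $\otimes$, ⅋ (par), $\oplus$, $\&$, $\mathbf{1},\bot,\mathbf{0},\top$, $\forall,\exists$, $=$, $\neq$) with least/greatest fixed points $\mu B\vec t,\nu B\vec t$ of monotonic operators, an unfolding rule for $\mu$ and a (co)induction rule for $\nu$ with coinvariant $S$ (from $\vdash\Gamma,S\vec t$ and $\vdash BS\vec x,(S\vec x)^\perp$ infer $\vdash\Gamma,\nu B\vec t$). A derivation is quasi-finite if it is cut-free, has finite height, and uses only finitely many distinct coinvariants. The $\mu$-focused system classifies ⅋, $\bot$, $\&$, $\top$, $\forall$, $\neq$, $\nu$ and negated atoms as asynchronous, and their duals ($\otimes,\mathbf{1},\oplus,\mathbf{0},\exists,=,\mu$, atoms) as synchronous. Sequents are $\vdash\Gamma\Uparrow\Delta$ (asynchronous phase) and $\vdash\Gamma\Downarrow P$ (focus on $P$), where $\Gamma$ contains only synchronous formulas or frozen formulas $P^*$ ($P$ a negated atom or greatest fixed point). In the asynchronous phase, asynchronous connectives are introduced in any order; a negated atom is frozen; a $\nu B\vec t$ is either coinducted on (with coinvariance premise $\vdash\ \Uparrow BS\vec x,(S\vec x)^\perp$) or frozen. In the synchronous phase, the focused formula's synchronous connectives are introduced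 hereditarily, $\mu B\vec t$ is either unfolded or closed by the axiom $\vdash(\nu\overline{B}\vec t)^*\Downarrow\mu B\vec t$, and an atom $a\vec t$ is closed by $\vdash(a^\perp\vec t)^*\Downarrow a\vec t$. Switching rules move synchronous formulas from $\Delta$ to $\Gamma$, start a focus on some $P$ from $\vdash\Gamma,P\Uparrow\ $ (empty $\Delta$), and release focus on an asynchronous formula. -}

module Defs where

open import Data.Nat using (ℕ; zero; suc; _+_)
open import Data.Fin using (Fin; zero; suc; _↑ˡ_; _↑ʳ_; splitAt)
open import Data.Vec using (Vec; []; _∷_; lookup; tabulate)
open import Data.List using (List; []; _∷_; _++_; map)
open import Data.List.Relation.Binary.Permutation.Propositional using (_↭_)
open import Data.List.Membership.Propositional using (_∈_)
open import Data.Product using (Σ; _×_; _,_)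
open import Data.Sum using (_⊎_; [_,_]′)
open import Data.Unit using (⊤; tt)
open import Data.Empty using (⊥)
open import Relation.Binary.PropositionalEquality using (_≡_)

record Sig : Set₁ where
  field
    Fun    : Set
    funAr  : Fun → ℕ
    Pred   : Set
    predAr : Pred → ℕ

module _ (𝕊 : Sig) where
  open Sig 𝕊

  private
    variable
      n m k j : ℕ
      Δ Δ' : List ℕ

  data Term (n : ℕ) : Set where
    var : Fin n → Term n
    fun : (f : Fun) → Vec (Term n) (funAr f) → Term n

  Ren : ℕ → ℕ → Set
  Ren n m = Fin n → Fin m

  Sub : ℕ → ℕ → Set
  Sub n m = Fin n → Term m

  mutual
    renT : Ren n m → Term n → Term m
    renT ρ (var i) = var (ρ i)
    renT ρ (fun f ts) = fun f (renTs ρ ts)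

    renTs : Ren n m → Vec (Term n) k → Vec (Term m) k
    renTs ρ [] = []
    renTs ρ (t ∷ ts) = renT ρ t ∷ renTs ρ ts

  mutual
    subT : Sub n m → Term n → Term m
    subT σ (var i) = σ i
    subT σ (fun f ts) = fun f (subTs σ ts)

    subTs : Sub n m → Vec (Term n) k → Vec (Term m) k
    subTs σ [] = []
    subTs σ (t ∷ ts) = subT σ t ∷ subTs σ ts

  liftR : (k : ℕ) → Ren n m → Ren (k + n) (k + m)
  liftR {m = m} k ρ i = [ (λ j → j ↑ˡ m) , (λ j → k ↑ʳ ρ j) ]′ (splitAt k i)

  liftS : (k : ℕ) → Sub n m → Sub (k + n) (k + m)
  liftS {m = m} k σ i =
    [ (λ j → var (j ↑ˡ m)) , (λ j → renT (k ↑ʳ_) (σ j)) ]′ (splitAt k i)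

  inst : Vec (Term n) k → Sub (k + n) n
  inst {k = k} ts i = [ lookup ts , var ]′ (splitAt k i)

  -- Formulas.  Δ lists the arities of the bound predicate variables
  -- (of enclosing fixed-point bodies).  Predicate variables only occur
  -- positively (there is no negated predicate variable), which makes
  -- every body B syntactically monotonic.  Negation is the defined
  -- De Morgan dual below.

  data PVar : List ℕ → ℕ → Set where
    pz : PVar (k ∷ Δ) k
    ps : PVar Δ k → PVar (j ∷ Δ) k

  infixr 6 _⊗_ _⅋_ _⊕_ _&_
  infix 8 _≐_ _≠_

  data Formula (Δ : List ℕ) (n : ℕ) : Set where
    atom natom : (a : Pred) → Vec (Term n) (predAr a) → Formula Δ n
    pvar   : PVar Δ k → Vec (Term n) k → Formula Δ n
    _⊗_ _⅋_ _⊕_ _&_ : Formula Δ n → Formula Δ n → Formula Δ n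
    𝟏 ⊥ₗ 𝟎 ⊤ₗ : Formula Δ n
    Forall Exists : Formula Δ (suc n) → Formula Δ n
    _≐_ _≠_ : Term n → Term n → Formula Δ n
    -- μ k B t / ν k B t : B = λp.λx⃗.body, x⃗ of length k bound as the
    -- k innermost term variables, p bound as predicate variable pz
    μ ν : (k : ℕ) → Formula (k ∷ Δ) (k + n) → Vec (Term n) k → Formula Δ n

  renF : Ren n m → Formula Δ n → Formula Δ m
  renF ρ (atom a ts) = atom a (renTs ρ ts)
  renF ρ (natom a ts) = natom a (renTs ρ ts)
  renF ρ (pvar x ts) = pvar x (renTs ρ ts)
  renF ρ (A ⊗ B) = renF ρ A ⊗ renF ρ B
  renF ρ (A ⅋ B) = renF ρ A ⅋ renF ρ B
  renF ρ (A ⊕ B) = renF ρ A ⊕ renF ρ B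
  renF ρ (A & B) = renF ρ A & renF ρ B
  renF ρ 𝟏 = 𝟏
  renF ρ ⊥ₗ = ⊥ₗ
  renF ρ 𝟎 = 𝟎
  renF ρ ⊤ₗ = ⊤ₗ
  renF ρ (Forall A) = Forall (renF (liftR 1 ρ) A)
  renF ρ (Exists A) = Exists (renF (liftR 1 ρ) A)
  renF ρ (s ≐ t) = renT ρ s ≐ renT ρ t
  renF ρ (s ≠ t) = renT ρ s ≠ renT ρ t
  renF ρ (μ k B ts) = μ k (renF (liftR k ρ) B) (renTs ρ ts)
  renF ρ (ν k B ts) = ν k (renF (liftR k ρ) B) (renTs ρ ts)

  subF : Sub n m → Formula Δ n → Formula Δ m
  subF σ (atom a ts) = atom a (subTs σ ts)
  subF σ (natom a ts) = natom a (subTs σ ts)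
  subF σ (pvar x ts) = pvar x (subTs σ ts)
  subF σ (A ⊗ B) = subF σ A ⊗ subF σ B
  subF σ (A ⅋ B) = subF σ A ⅋ subF σ B
  subF σ (A ⊕ B) = subF σ A ⊕ subF σ B
  subF σ (A & B) = subF σ A & subF σ B
  subF σ 𝟏 = 𝟏
  subF σ ⊥ₗ = ⊥ₗ
  subF σ 𝟎 = 𝟎
  subF σ ⊤ₗ = ⊤ₗ
  subF σ (Forall A) = Forall (subF (liftS 1 σ) A)
  subF σ (Exists A) = Exists (subF (liftS 1 σ) A)
  subF σ (s ≐ t) = subT σ s ≐ subT σ t
  subF σ (s ≠ t) = subT σ s ≠ subT σ t
  subF σ (μ k B ts) = μ k (subF (liftS k σ) B) (subTs σ ts)
  subF σ (ν k B ts) = ν k (subF (liftS k σ) B) (subTs σ ts)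

  PRen : List ℕ → List ℕ → Set
  PRen Δ Δ' = ∀ {k} → PVar Δ k → PVar Δ' k

  liftPR : PRen Δ Δ' → PRen (j ∷ Δ) (j ∷ Δ')
  liftPR ρ pz = pz
  liftPR ρ (ps x) = ps (ρ x)

  renP : PRen Δ Δ' → Formula Δ n → Formula Δ' n
  renP ρ (atom a ts) = atom a ts
  renP ρ (natom a ts) = natom a ts
  renP ρ (pvar x ts) = pvar (ρ x) ts
  renP ρ (A ⊗ B) = renP ρ A ⊗ renP ρ B
  renP ρ (A ⅋ B) = renP ρ A ⅋ renP ρ B
  renP ρ (A ⊕ B) = renP ρ A ⊕ renP ρ B
  renP ρ (A & B) = renP ρ A & renP ρ B
  renP ρ 𝟏 = 𝟏
  renP ρ ⊥ₗ = ⊥ₗ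
  renP ρ 𝟎 = 𝟎
  renP ρ ⊤ₗ = ⊤ₗ
  renP ρ (Forall A) = Forall (renP ρ A)
  renP ρ (Exists A) = Exists (renP ρ A)
  renP ρ (s ≐ t) = s ≐ t
  renP ρ (s ≠ t) = s ≠ t
  renP ρ (μ k B ts) = μ k (renP (liftPR ρ) B) ts
  renP ρ (ν k B ts) = ν k (renP (liftPR ρ) B) ts

  -- predicate substitution: a predicate of arity k in term context n is
  -- a formula in context k + n (its k arguments innermost)
  PSub : List ℕ → List ℕ → ℕ → Set
  PSub Δ Δ' n = ∀ {k} → PVar Δ k → Formula Δ' (k + n)

  psubUnder∀ : PSub Δ Δ' n → PSub Δ Δ' (suc n)
  psubUnder∀ σ {k} x = renF (liftR k suc) (σ x)

  psubUnderμ : (j : ℕ) → PSub Δ Δ' n → PSub (j ∷ Δ) (j ∷ Δ') (j + n)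
  psubUnderμ {n = n} j σ pz = pvar pz (tabulate (λ i → var (i ↑ˡ (j + n))))
  psubUnderμ j σ {k} (ps x) = renP ps (renF (liftR k (j ↑ʳ_)) (σ x))

  subP : PSub Δ Δ' n → Formula Δ n → Formula Δ' n
  subP σ (atom a ts) = atom a ts
  subP σ (natom a ts) = natom a ts
  subP σ (pvar x ts) = subF (inst ts) (σ x)
  subP σ (A ⊗ B) = subP σ A ⊗ subP σ B
  subP σ (A ⅋ B) = subP σ A ⅋ subP σ B
  subP σ (A ⊕ B) = subP σ A ⊕ subP σ B
  subP σ (A & B) = subP σ A & subP σ B
  subP σ 𝟏 = 𝟏
  subP σ ⊥ₗ = ⊥ₗ
  subP σ 𝟎 = 𝟎
  subP σ ⊤ₗ = ⊤ₗ
  subP σ (Forall A) = Forall (subP (psubUnder∀ σ) A)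
  subP σ (Exists A) = Exists (subP (psubUnder∀ σ) A)
  subP σ (s ≐ t) = s ≐ t
  subP σ (s ≠ t) = s ≠ t
  subP σ (μ j B ts) = μ j (subP (psubUnderμ j σ) B) ts
  subP σ (ν j B ts) = ν j (subP (psubUnderμ j σ) B) ts

  -- De Morgan negation  P ↦ P^⊥ ;  (μBt)^⊥ = ν B̄ t  with
  -- B̄ = λp.λx⃗.(B p^⊥ x⃗)^⊥ , so predicate variables are left unchanged
  dual : Formula Δ n → Formula Δ n
  dual (atom a ts) = natom a ts
  dual (natom a ts) = atom a ts
  dual (pvar x ts) = pvar x ts
  dual (A ⊗ B) = dual A ⅋ dual B
  dual (A ⅋ B) = dual A ⊗ dual B
  dual (A ⊕ B) = dual A & dual B
  dual (A & B) = dual A ⊕ dual B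
  dual 𝟏 = ⊥ₗ
  dual ⊥ₗ = 𝟏
  dual 𝟎 = ⊤ₗ
  dual ⊤ₗ = 𝟎
  dual (Forall A) = Exists (dual A)
  dual (Exists A) = Forall (dual A)
  dual (s ≐ t) = s ≠ t
  dual (s ≠ t) = s ≐ t
  dual (μ k B ts) = ν k (dual B) ts
  dual (ν k B ts) = μ k (dual B) ts

  unfoldμ : (k : ℕ) → Formula (k ∷ []) (k + n) → Vec (Term n) k → Formula [] n
  unfoldμ {n = n} k B ts = subF (inst ts) (subP σ B)
    where
      σ : PSub (k ∷ []) [] (k + n)
      σ pz = μ k (renF (liftR k (λ i → k ↑ʳ (k ↑ʳ i))) B)
                 (tabulate (λ i → var (i ↑ˡ (k + n))))
      σ (ps ())

  -- B S x⃗ (x⃗ = the k innermost variables), for a coinvariant S of arity k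
  applyB : (k : ℕ) → Formula (k ∷ []) (k + n) → Formula [] (k + n) → Formula [] (k + n)
  applyB {n = n} k B S = subP σ B
    where
      σ : PSub (k ∷ []) [] (k + n)
      σ pz = renF (liftR k (k ↑ʳ_)) S
      σ (ps ())

  applyS : Formula [] (k + n) → Vec (Term n) k → Formula [] n
  applyS S ts = subF (inst ts) S

  record CSU (s t : Term n) : Set₁ where
    field
      Idx     : Set
      ctx     : Idx → ℕ
      uni     : (u : Idx) → Sub n (ctx u)
      unifies : ∀ u → subT (uni u) s ≡ subT (uni u) t
      complete : ∀ {m} (θ : Sub n m) → subT θ s ≡ subT θ t →
                 Σ Idx λ u → Σ (Sub (ctx u) m) λ ρ → ∀ i → subT ρ (uni u i) ≡ θ i

  open CSU public

  private
    variable
      Γ Γ' : List (Formula [] n)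
      A B P : Formula [] n
      s t : Term n
      Bd : Formula (k ∷ []) (k + n)
      ts : Vec (Term n) k

  data Deriv : List (Formula [] n) → Set₁ where
    ex    : Γ ↭ Γ' → Deriv Γ → Deriv Γ'
    init  : (P : Formula [] n) → Deriv (P ∷ dual P ∷ [])
    cut   : (P : Formula [] n) → Deriv (P ∷ Γ) → Deriv (dual P ∷ Γ') → Deriv (Γ ++ Γ')
    ⊗r    : Deriv (A ∷ Γ) → Deriv (B ∷ Γ') → Deriv (A ⊗ B ∷ Γ ++ Γ')
    ⅋r    : Deriv (A ∷ B ∷ Γ) → Deriv (A ⅋ B ∷ Γ)
    ⊕r₁   : Deriv (A ∷ Γ) → Deriv (A ⊕ B ∷ Γ)
    ⊕r₂   : Deriv (B ∷ Γ) → Deriv (A ⊕ B ∷ Γ)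
    &r    : Deriv (A ∷ Γ) → Deriv (B ∷ Γ) → Deriv (A & B ∷ Γ)
    𝟏r    : Deriv {n} (𝟏 ∷ [])
    ⊥r    : Deriv Γ → Deriv (⊥ₗ ∷ Γ)
    ⊤r    : Deriv (⊤ₗ ∷ Γ)
    ∀r    : {A : Formula [] (suc n)} →
            Deriv (A ∷ map (renF suc) Γ) → Deriv (Forall A ∷ Γ)
    ∃r    : {A : Formula [] (suc n)} (t : Term n) →
            Deriv (subF (inst (t ∷ [])) A ∷ Γ) → Deriv (Exists A ∷ Γ)
    ≐r    : (t : Term n) → Deriv ((t ≐ t) ∷ [])
    ≠r    : (c : CSU s t) → (∀ u → Deriv (map (subF (uni c u)) Γ)) →
            Deriv ((s ≠ t) ∷ Γ)
    μr    : {Bd : Formula (k ∷ []) (k + n)} {ts : Vec (Term n) k} →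
            Deriv (unfoldμ k Bd ts ∷ Γ) → Deriv (μ k Bd ts ∷ Γ)
    νr    : (S : Formula [] (k + n)) →
            Deriv (applyS S ts ∷ Γ) →
            Deriv (applyB k Bd S ∷ dual S ∷ []) →
            Deriv (ν k Bd ts ∷ Γ)

  CutFree : Deriv Γ → Set
  CutFree (ex _ d) = CutFree d
  CutFree (init _) = ⊤
  CutFree (cut _ _ _) = ⊥
  CutFree (⊗r d e) = CutFree d × CutFree e
  CutFree (⅋r d) = CutFree d
  CutFree (⊕r₁ d) = CutFree d
  CutFree (⊕r₂ d) = CutFree d
  CutFree (&r d e) = CutFree d × CutFree e
  CutFree 𝟏r = ⊤
  CutFree (⊥r d) = CutFree d
  CutFree ⊤r = ⊤
  CutFree (∀r d) = CutFree d
  CutFree (∃r _ d) = CutFree d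
  CutFree (≐r _) = ⊤
  CutFree (≠r c ds) = ∀ u → CutFree (ds u)
  CutFree (μr d) = CutFree d
  CutFree (νr _ d e) = CutFree d × CutFree e

  HeightLE : ℕ → Deriv Γ → Set
  HeightLE zero _ = ⊥
  HeightLE (suc h) (ex _ d) = HeightLE h d
  HeightLE (suc h) (init _) = ⊤
  HeightLE (suc h) (cut _ d e) = HeightLE h d × HeightLE h e
  HeightLE (suc h) (⊗r d e) = HeightLE h d × HeightLE h e
  HeightLE (suc h) (⅋r d) = HeightLE h d
  HeightLE (suc h) (⊕r₁ d) = HeightLE h d
  HeightLE (suc h) (⊕r₂ d) = HeightLE h d
  HeightLE (suc h) (&r d e) = HeightLE h d × HeightLE h e
  HeightLE (suc h) 𝟏r = ⊤
  HeightLE (suc h) (⊥r d) = HeightLE h d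
  HeightLE (suc h) ⊤r = ⊤
  HeightLE (suc h) (∀r d) = HeightLE h d
  HeightLE (suc h) (∃r _ d) = HeightLE h d
  HeightLE (suc h) (≐r _) = ⊤
  HeightLE (suc h) (≠r c ds) = ∀ u → HeightLE h (ds u)
  HeightLE (suc h) (μr d) = HeightLE h d
  HeightLE (suc h) (νr _ d e) = HeightLE h d × HeightLE h e

  Coinv : Set
  Coinv = Σ ℕ λ n → Σ ℕ λ k → Formula [] (k + n)

  UsesCoinv : Coinv → Deriv Γ → Set
  UsesCoinv c (ex _ d) = UsesCoinv c d
  UsesCoinv c (init _) = ⊥
  UsesCoinv c (cut _ d e) = UsesCoinv c d ⊎ UsesCoinv c e
  UsesCoinv c (⊗r d e) = UsesCoinv c d ⊎ UsesCoinv c e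
  UsesCoinv c (⅋r d) = UsesCoinv c d
  UsesCoinv c (⊕r₁ d) = UsesCoinv c d
  UsesCoinv c (⊕r₂ d) = UsesCoinv c d
  UsesCoinv c (&r d e) = UsesCoinv c d ⊎ UsesCoinv c e
  UsesCoinv c 𝟏r = ⊥
  UsesCoinv c (⊥r d) = UsesCoinv c d
  UsesCoinv c ⊤r = ⊥
  UsesCoinv c (∀r d) = UsesCoinv c d
  UsesCoinv c (∃r _ d) = UsesCoinv c d
  UsesCoinv c (≐r _) = ⊥
  UsesCoinv c (≠r _ ds) = Σ _ λ u → UsesCoinv c (ds u)
  UsesCoinv c (μr d) = UsesCoinv c d
  UsesCoinv c (νr {k = k} {n = n} S d e) =
    (c ≡ (n , k , S)) ⊎ (UsesCoinv c d ⊎ UsesCoinv c e)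

  QuasiFinite : Deriv Γ → Set
  QuasiFinite d =
    CutFree d
    × Σ ℕ (λ h → HeightLE h d)
    × Σ (List Coinv) (λ L → ∀ c → UsesCoinv c d → c ∈ L)

  isSync : Formula Δ n → Set
  isSync (atom _ _) = ⊤
  isSync (_ ⊗ _) = ⊤
  isSync 𝟏 = ⊤
  isSync (_ ⊕ _) = ⊤
  isSync 𝟎 = ⊤
  isSync (Exists _) = ⊤
  isSync (_ ≐ _) = ⊤
  isSync (μ _ _ _) = ⊤
  isSync _ = ⊥

  isAsync : Formula Δ n → Set
  isAsync (natom _ _) = ⊤
  isAsync (_ ⅋ _) = ⊤
  isAsync ⊥ₗ = ⊤
  isAsync (_ & _) = ⊤
  isAsync ⊤ₗ = ⊤
  isAsync (Forall _) = ⊤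
  isAsync (_ ≠ _) = ⊤
  isAsync (ν _ _ _) = ⊤
  isAsync _ = ⊥

  -- items of the left zone Γ: a (synchronous) formula, or a frozen P*
  data Item (n : ℕ) : Set where
    ⟨_⟩ : Formula [] n → Item n
    _*  : Formula [] n → Item n

  renI : Ren n m → Item n → Item m
  renI ρ ⟨ P ⟩ = ⟨ renF ρ P ⟩
  renI ρ (P *) = renF ρ P *

  subI : Sub n m → Item n → Item m
  subI σ ⟨ P ⟩ = ⟨ subF σ P ⟩
  subI σ (P *) = subF σ P *

  private
    variable
      Ξ Ξ' : List (Item n)
      Ω Ω' : List (Formula [] n)

  -- Async Ξ Ω  is  ⊢ Ξ ⇑ Ω ;   Focus Ξ P  is  ⊢ Ξ ⇓ P
  mutual
    data Async : List (Item n) → List (Formula [] n) → Set₁ where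
      exΞ  : Ξ ↭ Ξ' → Async Ξ Ω → Async Ξ' Ω
      exΩ  : Ω ↭ Ω' → Async Ξ Ω → Async Ξ Ω'
      ⅋a   : Async Ξ (A ∷ B ∷ Ω) → Async Ξ (A ⅋ B ∷ Ω)
      ⊥a   : Async Ξ Ω → Async Ξ (⊥ₗ ∷ Ω)
      &a   : Async Ξ (A ∷ Ω) → Async Ξ (B ∷ Ω) → Async Ξ (A & B ∷ Ω)
      ⊤a   : Async Ξ (⊤ₗ ∷ Ω)
      ∀a   : {A : Formula [] (suc n)} →
             Async (map (renI suc) Ξ) (A ∷ map (renF suc) Ω) →
             Async Ξ (Forall A ∷ Ω)
      ≠a   : (c : CSU s t) →
             (∀ u → Async (map (subI (uni c u)) Ξ) (map (subF (uni c u)) Ω)) →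
             Async Ξ ((s ≠ t) ∷ Ω)
      νa   : (S : Formula [] (k + n)) →
             Async Ξ (applyS S ts ∷ Ω) →
             Async [] (applyB k Bd S ∷ dual S ∷ []) →
             Async Ξ (ν k Bd ts ∷ Ω)
      νfrz : {Bd : Formula (k ∷ []) (k + n)} {ts : Vec (Term n) k} →
            Async ((ν k Bd ts *) ∷ Ξ) Ω → Async Ξ (ν k Bd ts ∷ Ω)
      nfrz : {a : Pred} {us : Vec (Term n) (predAr a)} →
             Async ((natom a us *) ∷ Ξ) Ω → Async Ξ (natom a us ∷ Ω)
      store : isSync P → Async (⟨ P ⟩ ∷ Ξ) Ω → Async Ξ (P ∷ Ω)
      focus : Focus Ξ P → Async (⟨ P ⟩ ∷ Ξ) []

    data Focus : List (Item n) → Formula [] n → Set₁ where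
      exF   : Ξ ↭ Ξ' → Focus Ξ P → Focus Ξ' P
      ⊗s    : Focus Ξ A → Focus Ξ' B → Focus (Ξ ++ Ξ') (A ⊗ B)
      𝟏s    : Focus {n} [] 𝟏
      ⊕s₁   : Focus Ξ A → Focus Ξ (A ⊕ B)
      ⊕s₂   : Focus Ξ B → Focus Ξ (A ⊕ B)
      ∃s    : {A : Formula [] (suc n)} (t : Term n) →
              Focus Ξ (subF (inst (t ∷ [])) A) → Focus Ξ (Exists A)
      ≐s    : (t : Term n) → Focus [] (t ≐ t)
      μs    : {Bd : Formula (k ∷ []) (k + n)} {ts : Vec (Term n) k} →
            Focus Ξ (unfoldμ k Bd ts) → Focus Ξ (μ k Bd ts)
      μinit : {Bd : Formula (k ∷ []) (k + n)} {ts : Vec (Term n) k} →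
            Focus ((ν k (dual Bd) ts *) ∷ []) (μ k Bd ts)
      ainit : {a : Pred} {us : Vec (Term n) (predAr a)} →
              Focus ((natom a us *) ∷ []) (atom a us)
      release : isAsync P → Async Ξ (P ∷ []) → Focus Ξ P

{-# OPTIONS --safe #-}
module Submission where

import Defs as D
open import Data.Empty using (⊥-elim)
open import Data.Fin using (Fin; zero; suc; _↑ˡ_; _↑ʳ_)
open import Data.Fin.Properties using (splitAt-↑ˡ; splitAt-↑ʳ)
open import Data.List using (List; []; _∷_; _++_; map)
open import Data.List.Membership.Propositional using (_∈_)
open import Data.List.Membership.Propositional.Properties using (∈-∃++; ∈-++⁻)
open import Data.List.Properties using (map-∘; map-cong; map-id; map-++; ++-assoc; ++-identityʳ)
open import Data.List.Relation.Binary.Permutation.Propositional using (_↭_; refl; prep; swap; ↭-refl; ↭-trans; ↭-sym; ↭-reflexive)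
open import Data.List.Relation.Binary.Permutation.Propositional.Properties using (map⁺; ++-comm; shift; shifts; ++⁺ˡ; ++⁺ʳ; drop-∷; ∈-resp-↭; ¬x∷xs↭[]; ↭-singleton-inv)
open import Data.List.Relation.Unary.Any using (here; there)
open import Data.Nat using (ℕ; zero; suc; _+_)
open import Data.Product using (Σ; ∃; _×_; _,_; proj₁; proj₂) renaming (swap to ×-swap)
open import Data.Sum using (_⊎_; inj₁; inj₂; [_,_]′)
open import Data.Unit using (tt)
open import Data.Vec using (Vec; []; _∷_; lookup; tabulate)
open import Data.Vec.Properties using (lookup∘tabulate; tabulate∘lookup; tabulate-cong)
open import Function using (_∘_)
open import Relation.Binary.PropositionalEquality using (_≡_; _≗_; refl; sym; trans; cong; cong₂; subst; subst₂; module ≡-Reasoning)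
import Data.List.Relation.Binary.Permutation.Propositional as Perm

-- Focusing usually has to merge the coinvariants that different branches use for
-- one occurrence of a greatest fixed point.  Here merging is avoided by a delay:
-- S = νBx ⊕ 𝟎 is always a coinvariant of B (functoriality of B, with the identity
-- on νB), and coinducting on νBt with it leaves the synchronous formula νBt ⊕ 𝟎.
-- That formula can be stored, and focusing on it at any later time releases νBt,
-- which is then coinducted on or frozen as the given derivation does.
-- With delays every asynchronous formula decomposes into stored or frozen items by
-- a process that terminates on the size of the formula, the whole asynchronous
-- phase is invertible, and the synchronous rules become admissible by permuting
-- them up to the points where their premises are focused on.

module Focalization (𝕊 : D.Sig) where

  open ≡-Reasoning
  open D using
    ( var; fun; pz; ps; atom; natom; pvar; _⊗_; _⅋_; _⊕_; _&_; 𝟏; ⊥ₗ; 𝟎; ⊤ₗ; Forall; Exists; _≐_; _≠_; μ; ν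
    ; uni; complete; ex; init; ⊗r; ⅋r; ⊕r₁; ⊕r₂; &r; 𝟏r; ⊥r; ⊤r; ∀r; ∃r; ≐r; ≠r; μr; νr; ⟨_⟩; _*
    ; exΞ; exΩ; ⅋a; ⊥a; &a; ⊤a; ∀a; ≠a; νa; νfrz; nfrz; store; focus
    ; exF; ⊗s; 𝟏s; ⊕s₁; ⊕s₂; ∃s; ≐s; μs; μinit; ainit; release )

  Term    = D.Term 𝕊
  Formula = D.Formula 𝕊
  Item    = D.Item 𝕊
  Ren     = D.Ren 𝕊
  Sub     = D.Sub 𝕊
  PVar    = D.PVar 𝕊
  PRen    = D.PRen 𝕊
  PSub    = D.PSub 𝕊

  variable
    n m l k j : ℕ
    Δ Δ′ Δ″ : List ℕ

  renT : Ren n m → Term n → Term m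
  renT = D.renT 𝕊
  renTs : Ren n m → Vec (Term n) k → Vec (Term m) k
  renTs = D.renTs 𝕊
  subT : Sub n m → Term n → Term m
  subT = D.subT 𝕊
  subTs : Sub n m → Vec (Term n) k → Vec (Term m) k
  subTs = D.subTs 𝕊
  liftR : (k : ℕ) → Ren n m → Ren (k + n) (k + m)
  liftR = D.liftR 𝕊
  liftS : (k : ℕ) → Sub n m → Sub (k + n) (k + m)
  liftS = D.liftS 𝕊
  inst : Vec (Term n) k → Sub (k + n) n
  inst = D.inst 𝕊
  renF : Ren n m → Formula Δ n → Formula Δ m
  renF = D.renF 𝕊
  subF : Sub n m → Formula Δ n → Formula Δ m
  subF = D.subF 𝕊
  renP : PRen Δ Δ′ → Formula Δ n → Formula Δ′ n
  renP = D.renP 𝕊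
  subP : PSub Δ Δ′ n → Formula Δ n → Formula Δ′ n
  subP = D.subP 𝕊
  psubUnder∀ : PSub Δ Δ′ n → PSub Δ Δ′ (suc n)
  psubUnder∀ = D.psubUnder∀ 𝕊
  psubUnderμ : (j : ℕ) → PSub Δ Δ′ n → PSub (j ∷ Δ) (j ∷ Δ′) (j + n)
  psubUnderμ = D.psubUnderμ 𝕊
  liftPR : PRen Δ Δ′ → PRen (j ∷ Δ) (j ∷ Δ′)
  liftPR = D.liftPR 𝕊
  dual : Formula Δ n → Formula Δ n
  dual = D.dual 𝕊
  unfoldμ : (k : ℕ) → Formula (k ∷ []) (k + n) → Vec (Term n) k → Formula [] n
  unfoldμ = D.unfoldμ 𝕊
  applyB : (k : ℕ) → Formula (k ∷ []) (k + n) → Formula [] (k + n) → Formula [] (k + n)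
  applyB = D.applyB 𝕊
  applyS : Formula [] (k + n) → Vec (Term n) k → Formula [] n
  applyS = D.applyS 𝕊

  infixr 9 _∘ₛ_
  _∘ₛ_ : Sub m l → Sub n m → Sub n l
  (τ ∘ₛ σ) i = subT τ (σ i)

  wk : (k : ℕ) → Sub n (k + n)
  wk k i = var (k ↑ʳ i)

  vars : (k n : ℕ) → Vec (Term (k + n)) k
  vars k n = tabulate (λ i → var (i ↑ˡ n))

  -- Substitution in terms

  ↑-elim : ∀ k {n} (P : Fin (k + n) → Set) → (∀ i → P (i ↑ˡ n)) → (∀ i → P (k ↑ʳ i)) → ∀ i → P i
  ↑-elim zero    P l r i       = r i
  ↑-elim (suc k) P l r zero    = l zero
  ↑-elim (suc k) P l r (suc i) = ↑-elim k (P ∘ suc) (l ∘ suc) r i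

  mutual
    subT-cong : {σ τ : Sub n m} → σ ≗ τ → (t : Term n) → subT σ t ≡ subT τ t
    subT-cong e (var i)    = e i
    subT-cong e (fun f ts) = cong (fun f) (subTs-cong e ts)

    subTs-cong : {σ τ : Sub n m} → σ ≗ τ → (ts : Vec (Term n) k) → subTs σ ts ≡ subTs τ ts
    subTs-cong e []       = refl
    subTs-cong e (t ∷ ts) = cong₂ _∷_ (subT-cong e t) (subTs-cong e ts)

  mutual
    renT≡subT : (ρ : Ren n m) (t : Term n) → renT ρ t ≡ subT (var ∘ ρ) t
    renT≡subT ρ (var i)    = refl
    renT≡subT ρ (fun f ts) = cong (fun f) (renTs≡subTs ρ ts)

    renTs≡subTs : (ρ : Ren n m) (ts : Vec (Term n) k) → renTs ρ ts ≡ subTs (var ∘ ρ) ts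
    renTs≡subTs ρ []       = refl
    renTs≡subTs ρ (t ∷ ts) = cong₂ _∷_ (renT≡subT ρ t) (renTs≡subTs ρ ts)

  mutual
    subT-∘ : (τ : Sub m l) (σ : Sub n m) (t : Term n) → subT τ (subT σ t) ≡ subT (τ ∘ₛ σ) t
    subT-∘ τ σ (var i)    = refl
    subT-∘ τ σ (fun f ts) = cong (fun f) (subTs-∘ τ σ ts)

    subTs-∘ : (τ : Sub m l) (σ : Sub n m) (ts : Vec (Term n) k) →
              subTs τ (subTs σ ts) ≡ subTs (τ ∘ₛ σ) ts
    subTs-∘ τ σ []       = refl
    subTs-∘ τ σ (t ∷ ts) = cong₂ _∷_ (subT-∘ τ σ t) (subTs-∘ τ σ ts)

  mutual
    subT-var : (t : Term n) → subT var t ≡ t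
    subT-var (var i)    = refl
    subT-var (fun f ts) = cong (fun f) (subTs-var ts)

    subTs-var : (ts : Vec (Term n) k) → subTs var ts ≡ ts
    subTs-var []       = refl
    subTs-var (t ∷ ts) = cong₂ _∷_ (subT-var t) (subTs-var ts)

  lookup-subTs : (σ : Sub n m) (ts : Vec (Term n) k) (i : Fin k) →
                 lookup (subTs σ ts) i ≡ subT σ (lookup ts i)
  lookup-subTs σ (t ∷ ts) zero    = refl
  lookup-subTs σ (t ∷ ts) (suc i) = lookup-subTs σ ts i

  subTs-tabulate : (σ : Sub n m) (f : Fin k → Term n) → subTs σ (tabulate f) ≡ tabulate (subT σ ∘ f)
  subTs-tabulate {k = zero}  σ f = refl
  subTs-tabulate {k = suc k} σ f = cong (subT σ (f zero) ∷_) (subTs-tabulate σ (f ∘ suc))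

  liftS-↑ˡ : ∀ k (σ : Sub n m) i → liftS k σ (i ↑ˡ n) ≡ var (i ↑ˡ m)
  liftS-↑ˡ {n = n} k σ i = cong [ _ , _ ]′ (splitAt-↑ˡ k i n)

  liftS-↑ʳ : ∀ k (σ : Sub n m) i → liftS k σ (k ↑ʳ i) ≡ subT (wk k) (σ i)
  liftS-↑ʳ {n = n} k σ i = trans (cong [ _ , _ ]′ (splitAt-↑ʳ k n i)) (renT≡subT _ (σ i))

  inst-↑ˡ : (ts : Vec (Term n) k) (i : Fin k) → inst ts (i ↑ˡ n) ≡ lookup ts i
  inst-↑ˡ {n = n} {k = k} ts i = cong [ _ , _ ]′ (splitAt-↑ˡ k i n)

  inst-↑ʳ : (ts : Vec (Term n) k) (i : Fin n) → inst ts (k ↑ʳ i) ≡ var i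
  inst-↑ʳ {n = n} {k = k} ts i = cong [ _ , _ ]′ (splitAt-↑ʳ k n i)

  liftS-cong : ∀ k {σ τ : Sub n m} → σ ≗ τ → liftS k σ ≗ liftS k τ
  liftS-cong k {σ} {τ} e = ↑-elim k _
    (λ i → trans (liftS-↑ˡ k σ i) (sym (liftS-↑ˡ k τ i)))
    (λ i → trans (liftS-↑ʳ k σ i) (trans (cong (subT (wk k)) (e i)) (sym (liftS-↑ʳ k τ i))))

  liftS-var : ∀ k → liftS k var ≗ var {n = k + n}
  liftS-var k = ↑-elim k _ (liftS-↑ˡ k var) (liftS-↑ʳ k var)

  liftS-wk : ∀ k (σ : Sub n m) → liftS k σ ∘ₛ wk k ≗ wk k ∘ₛ σ
  liftS-wk k σ i = liftS-↑ʳ k σ i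

  liftS-∘ : ∀ k (τ : Sub m l) (σ : Sub n m) → liftS k τ ∘ₛ liftS k σ ≗ liftS k (τ ∘ₛ σ)
  liftS-∘ k τ σ = ↑-elim k _
    (λ i → begin
      subT (liftS k τ) (liftS k σ (i ↑ˡ _)) ≡⟨ cong (subT (liftS k τ)) (liftS-↑ˡ k σ i) ⟩
      liftS k τ (i ↑ˡ _)                    ≡⟨ liftS-↑ˡ k τ i ⟩
      var (i ↑ˡ _)                          ≡⟨ liftS-↑ˡ k (τ ∘ₛ σ) i ⟨
      liftS k (τ ∘ₛ σ) (i ↑ˡ _)             ∎)
    (λ i → begin
      subT (liftS k τ) (liftS k σ (k ↑ʳ i)) ≡⟨ cong (subT (liftS k τ)) (liftS-↑ʳ k σ i) ⟩
      subT (liftS k τ) (subT (wk k) (σ i))  ≡⟨ subT-∘ _ _ (σ i) ⟩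
      subT (liftS k τ ∘ₛ wk k) (σ i)        ≡⟨ subT-cong (liftS-wk k τ) (σ i) ⟩
      subT (wk k ∘ₛ τ) (σ i)                ≡⟨ subT-∘ _ _ (σ i) ⟨
      subT (wk k) (subT τ (σ i))            ≡⟨ liftS-↑ʳ k (τ ∘ₛ σ) i ⟨
      liftS k (τ ∘ₛ σ) (k ↑ʳ i)             ∎)

  liftS-ren : ∀ k (ρ : Ren n m) → liftS k (var ∘ ρ) ≗ var ∘ liftR k ρ
  liftS-ren k ρ = ↑-elim k _
    (λ i → trans (liftS-↑ˡ k (var ∘ ρ) i) (cong var (sym (cong [ _ , _ ]′ (splitAt-↑ˡ k i _)))))
    (λ i → trans (liftS-↑ʳ k (var ∘ ρ) i) (cong var (sym (cong [ _ , _ ]′ (splitAt-↑ʳ k _ i)))))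

  inst-natural : (θ : Sub n m) (ts : Vec (Term n) k) → θ ∘ₛ inst ts ≗ inst (subTs θ ts) ∘ₛ liftS k θ
  inst-natural {k = k} θ ts = ↑-elim k _
    (λ i → begin
      subT θ (inst ts (i ↑ˡ _))                    ≡⟨ cong (subT θ) (inst-↑ˡ ts i) ⟩
      subT θ (lookup ts i)                         ≡⟨ lookup-subTs θ ts i ⟨
      lookup (subTs θ ts) i                        ≡⟨ inst-↑ˡ (subTs θ ts) i ⟨
      inst (subTs θ ts) (i ↑ˡ _)                   ≡⟨ cong (subT (inst (subTs θ ts))) (liftS-↑ˡ k θ i) ⟨
      subT (inst (subTs θ ts)) (liftS k θ (i ↑ˡ _)) ∎)
    (λ i → begin
      subT θ (inst ts (k ↑ʳ i))                    ≡⟨ cong (subT θ) (inst-↑ʳ ts i) ⟩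
      θ i                                          ≡⟨ subT-var (θ i) ⟨
      subT var (θ i)                               ≡⟨ subT-cong (inst-↑ʳ (subTs θ ts)) (θ i) ⟨
      subT (inst (subTs θ ts) ∘ₛ wk k) (θ i)       ≡⟨ subT-∘ _ _ (θ i) ⟨
      subT (inst (subTs θ ts)) (subT (wk k) (θ i)) ≡⟨ cong (subT (inst (subTs θ ts))) (liftS-↑ʳ k θ i) ⟨
      subT (inst (subTs θ ts)) (liftS k θ (k ↑ʳ i)) ∎)

  inst-vars : ∀ k n → inst (vars k n) ∘ₛ liftS k (wk k) ≗ var
  inst-vars k n = ↑-elim k _
    (λ i → trans (cong (subT (inst (vars k n))) (liftS-↑ˡ k (wk k) i))
                 (trans (inst-↑ˡ (vars k n) i) (lookup∘tabulate _ i)))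
    (λ i → trans (cong (subT (inst (vars k n))) (liftS-↑ʳ k (wk k) i)) (inst-↑ʳ (vars k n) (k ↑ʳ i)))

  subTs-inst-vars : (ts : Vec (Term n) k) → subTs (inst ts) (vars k n) ≡ ts
  subTs-inst-vars ts = trans (subTs-tabulate _ _) (trans (tabulate-cong (inst-↑ˡ ts)) (tabulate∘lookup ts))

  subTs-liftS-vars : ∀ k (σ : Sub n m) → subTs (liftS k σ) (vars k n) ≡ vars k m
  subTs-liftS-vars k σ = trans (subTs-tabulate _ _) (tabulate-cong (liftS-↑ˡ k σ))

  -- Substitution in formulas

  subF-cong : {σ τ : Sub n m} → σ ≗ τ → (A : Formula Δ n) → subF σ A ≡ subF τ A
  subF-cong e (atom a ts)  = cong (atom a) (subTs-cong e ts)
  subF-cong e (natom a ts) = cong (natom a) (subTs-cong e ts)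
  subF-cong e (pvar x ts)  = cong (pvar x) (subTs-cong e ts)
  subF-cong e (A ⊗ B)      = cong₂ _⊗_ (subF-cong e A) (subF-cong e B)
  subF-cong e (A ⅋ B)      = cong₂ _⅋_ (subF-cong e A) (subF-cong e B)
  subF-cong e (A ⊕ B)      = cong₂ _⊕_ (subF-cong e A) (subF-cong e B)
  subF-cong e (A & B)      = cong₂ _&_ (subF-cong e A) (subF-cong e B)
  subF-cong e 𝟏            = refl
  subF-cong e ⊥ₗ           = refl
  subF-cong e 𝟎            = refl
  subF-cong e ⊤ₗ           = refl
  subF-cong e (Forall A)   = cong Forall (subF-cong (liftS-cong 1 e) A)
  subF-cong e (Exists A)   = cong Exists (subF-cong (liftS-cong 1 e) A)
  subF-cong e (s ≐ t)      = cong₂ _≐_ (subT-cong e s) (subT-cong e t)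
  subF-cong e (s ≠ t)      = cong₂ _≠_ (subT-cong e s) (subT-cong e t)
  subF-cong e (μ k B ts)   = cong₂ (μ k) (subF-cong (liftS-cong k e) B) (subTs-cong e ts)
  subF-cong e (ν k B ts)   = cong₂ (ν k) (subF-cong (liftS-cong k e) B) (subTs-cong e ts)

  renF≡subF : (ρ : Ren n m) (A : Formula Δ n) → renF ρ A ≡ subF (var ∘ ρ) A

  renF-liftR≡subF : ∀ k (ρ : Ren n m) (A : Formula Δ (k + n)) →
                    renF (liftR k ρ) A ≡ subF (liftS k (var ∘ ρ)) A
  renF-liftR≡subF k ρ A = trans (renF≡subF (liftR k ρ) A) (sym (subF-cong (liftS-ren k ρ) A))

  renF≡subF ρ (atom a ts)  = cong (atom a) (renTs≡subTs ρ ts)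
  renF≡subF ρ (natom a ts) = cong (natom a) (renTs≡subTs ρ ts)
  renF≡subF ρ (pvar x ts)  = cong (pvar x) (renTs≡subTs ρ ts)
  renF≡subF ρ (A ⊗ B)      = cong₂ _⊗_ (renF≡subF ρ A) (renF≡subF ρ B)
  renF≡subF ρ (A ⅋ B)      = cong₂ _⅋_ (renF≡subF ρ A) (renF≡subF ρ B)
  renF≡subF ρ (A ⊕ B)      = cong₂ _⊕_ (renF≡subF ρ A) (renF≡subF ρ B)
  renF≡subF ρ (A & B)      = cong₂ _&_ (renF≡subF ρ A) (renF≡subF ρ B)
  renF≡subF ρ 𝟏            = refl
  renF≡subF ρ ⊥ₗ           = refl
  renF≡subF ρ 𝟎            = refl
  renF≡subF ρ ⊤ₗ           = refl
  renF≡subF ρ (Forall A)   = cong Forall (renF-liftR≡subF 1 ρ A)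
  renF≡subF ρ (Exists A)   = cong Exists (renF-liftR≡subF 1 ρ A)
  renF≡subF ρ (s ≐ t)      = cong₂ _≐_ (renT≡subT ρ s) (renT≡subT ρ t)
  renF≡subF ρ (s ≠ t)      = cong₂ _≠_ (renT≡subT ρ s) (renT≡subT ρ t)
  renF≡subF ρ (μ k B ts)   = cong₂ (μ k) (renF-liftR≡subF k ρ B) (renTs≡subTs ρ ts)
  renF≡subF ρ (ν k B ts)   = cong₂ (ν k) (renF-liftR≡subF k ρ B) (renTs≡subTs ρ ts)

  subF-∘ : (τ : Sub m l) (σ : Sub n m) (A : Formula Δ n) → subF τ (subF σ A) ≡ subF (τ ∘ₛ σ) A

  subF-liftS-∘ : ∀ k (τ : Sub m l) (σ : Sub n m) (A : Formula Δ (k + n)) →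
                 subF (liftS k τ) (subF (liftS k σ) A) ≡ subF (liftS k (τ ∘ₛ σ)) A
  subF-liftS-∘ k τ σ A = trans (subF-∘ (liftS k τ) (liftS k σ) A) (subF-cong (liftS-∘ k τ σ) A)

  subF-∘ τ σ (atom a ts)  = cong (atom a) (subTs-∘ τ σ ts)
  subF-∘ τ σ (natom a ts) = cong (natom a) (subTs-∘ τ σ ts)
  subF-∘ τ σ (pvar x ts)  = cong (pvar x) (subTs-∘ τ σ ts)
  subF-∘ τ σ (A ⊗ B)      = cong₂ _⊗_ (subF-∘ τ σ A) (subF-∘ τ σ B)
  subF-∘ τ σ (A ⅋ B)      = cong₂ _⅋_ (subF-∘ τ σ A) (subF-∘ τ σ B)
  subF-∘ τ σ (A ⊕ B)      = cong₂ _⊕_ (subF-∘ τ σ A) (subF-∘ τ σ B)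
  subF-∘ τ σ (A & B)      = cong₂ _&_ (subF-∘ τ σ A) (subF-∘ τ σ B)
  subF-∘ τ σ 𝟏            = refl
  subF-∘ τ σ ⊥ₗ           = refl
  subF-∘ τ σ 𝟎            = refl
  subF-∘ τ σ ⊤ₗ           = refl
  subF-∘ τ σ (Forall A)   = cong Forall (subF-liftS-∘ 1 τ σ A)
  subF-∘ τ σ (Exists A)   = cong Exists (subF-liftS-∘ 1 τ σ A)
  subF-∘ τ σ (s ≐ t)      = cong₂ _≐_ (subT-∘ τ σ s) (subT-∘ τ σ t)
  subF-∘ τ σ (s ≠ t)      = cong₂ _≠_ (subT-∘ τ σ s) (subT-∘ τ σ t)
  subF-∘ τ σ (μ k B ts)   = cong₂ (μ k) (subF-liftS-∘ k τ σ B) (subTs-∘ τ σ ts)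
  subF-∘ τ σ (ν k B ts)   = cong₂ (ν k) (subF-liftS-∘ k τ σ B) (subTs-∘ τ σ ts)

  subF-id : {σ : Sub n n} → σ ≗ var → (A : Formula Δ n) → subF σ A ≡ A

  subF-liftS-id : ∀ k {σ : Sub n n} → σ ≗ var → (A : Formula Δ (k + n)) → subF (liftS k σ) A ≡ A
  subF-liftS-id k e = subF-id (λ i → trans (liftS-cong k e i) (liftS-var k i))

  subTs-id : {σ : Sub n n} → σ ≗ var → (ts : Vec (Term n) k) → subTs σ ts ≡ ts
  subTs-id e ts = trans (subTs-cong e ts) (subTs-var ts)

  subT-id : {σ : Sub n n} → σ ≗ var → (t : Term n) → subT σ t ≡ t
  subT-id e t = trans (subT-cong e t) (subT-var t)

  subF-id e (atom a ts)  = cong (atom a) (subTs-id e ts)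
  subF-id e (natom a ts) = cong (natom a) (subTs-id e ts)
  subF-id e (pvar x ts)  = cong (pvar x) (subTs-id e ts)
  subF-id e (A ⊗ B)      = cong₂ _⊗_ (subF-id e A) (subF-id e B)
  subF-id e (A ⅋ B)      = cong₂ _⅋_ (subF-id e A) (subF-id e B)
  subF-id e (A ⊕ B)      = cong₂ _⊕_ (subF-id e A) (subF-id e B)
  subF-id e (A & B)      = cong₂ _&_ (subF-id e A) (subF-id e B)
  subF-id e 𝟏            = refl
  subF-id e ⊥ₗ           = refl
  subF-id e 𝟎            = refl
  subF-id e ⊤ₗ           = refl
  subF-id e (Forall A)   = cong Forall (subF-liftS-id 1 e A)
  subF-id e (Exists A)   = cong Exists (subF-liftS-id 1 e A)
  subF-id e (s ≐ t)      = cong₂ _≐_ (subT-id e s) (subT-id e t)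
  subF-id e (s ≠ t)      = cong₂ _≠_ (subT-id e s) (subT-id e t)
  subF-id e (μ k B ts)   = cong₂ (μ k) (subF-liftS-id k e B) (subTs-id e ts)
  subF-id e (ν k B ts)   = cong₂ (ν k) (subF-liftS-id k e B) (subTs-id e ts)

  subF-var : (A : Formula Δ n) → subF var A ≡ A
  subF-var = subF-id (λ _ → refl)

  subF-square : {τ : Sub m l} {σ : Sub n m} {τ′ : Sub j l} {σ′ : Sub n j} →
                τ ∘ₛ σ ≗ τ′ ∘ₛ σ′ → (A : Formula Δ n) → subF τ (subF σ A) ≡ subF τ′ (subF σ′ A)
  subF-square e A = trans (subF-∘ _ _ A) (trans (subF-cong e A) (sym (subF-∘ _ _ A)))

  liftS-square : ∀ k {τ : Sub m l} {σ : Sub n m} {τ′ : Sub j l} {σ′ : Sub n j} →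
                 τ ∘ₛ σ ≗ τ′ ∘ₛ σ′ → liftS k τ ∘ₛ liftS k σ ≗ liftS k τ′ ∘ₛ liftS k σ′
  liftS-square k e i = trans (liftS-∘ k _ _ i) (trans (liftS-cong k e i) (sym (liftS-∘ k _ _ i)))

  subF-inst : (θ : Sub n m) (ts : Vec (Term n) k) (A : Formula Δ (k + n)) →
              subF θ (subF (inst ts) A) ≡ subF (inst (subTs θ ts)) (subF (liftS k θ) A)
  subF-inst θ ts = subF-square (inst-natural θ ts)

  -- Duality

  dual-involutive : (A : Formula Δ n) → dual (dual A) ≡ A
  dual-involutive (atom a ts)  = refl
  dual-involutive (natom a ts) = refl
  dual-involutive (pvar x ts)  = refl
  dual-involutive (A ⊗ B)      = cong₂ _⊗_ (dual-involutive A) (dual-involutive B)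
  dual-involutive (A ⅋ B)      = cong₂ _⅋_ (dual-involutive A) (dual-involutive B)
  dual-involutive (A ⊕ B)      = cong₂ _⊕_ (dual-involutive A) (dual-involutive B)
  dual-involutive (A & B)      = cong₂ _&_ (dual-involutive A) (dual-involutive B)
  dual-involutive 𝟏            = refl
  dual-involutive ⊥ₗ           = refl
  dual-involutive 𝟎            = refl
  dual-involutive ⊤ₗ           = refl
  dual-involutive (Forall A)   = cong Forall (dual-involutive A)
  dual-involutive (Exists A)   = cong Exists (dual-involutive A)
  dual-involutive (s ≐ t)      = refl
  dual-involutive (s ≠ t)      = refl
  dual-involutive (μ k B ts)   = cong (λ C → μ k C ts) (dual-involutive B)
  dual-involutive (ν k B ts)   = cong (λ C → ν k C ts) (dual-involutive B)

  subF-dual : (σ : Sub n m) (A : Formula Δ n) → subF σ (dual A) ≡ dual (subF σ A)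
  subF-dual σ (atom a ts)  = refl
  subF-dual σ (natom a ts) = refl
  subF-dual σ (pvar x ts)  = refl
  subF-dual σ (A ⊗ B)      = cong₂ _⅋_ (subF-dual σ A) (subF-dual σ B)
  subF-dual σ (A ⅋ B)      = cong₂ _⊗_ (subF-dual σ A) (subF-dual σ B)
  subF-dual σ (A ⊕ B)      = cong₂ _&_ (subF-dual σ A) (subF-dual σ B)
  subF-dual σ (A & B)      = cong₂ _⊕_ (subF-dual σ A) (subF-dual σ B)
  subF-dual σ 𝟏            = refl
  subF-dual σ ⊥ₗ           = refl
  subF-dual σ 𝟎            = refl
  subF-dual σ ⊤ₗ           = refl
  subF-dual σ (Forall A)   = cong Exists (subF-dual (liftS 1 σ) A)
  subF-dual σ (Exists A)   = cong Forall (subF-dual (liftS 1 σ) A)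
  subF-dual σ (s ≐ t)      = refl
  subF-dual σ (s ≠ t)      = refl
  subF-dual σ (μ k B ts)   = cong (λ C → ν k C (subTs σ ts)) (subF-dual (liftS k σ) B)
  subF-dual σ (ν k B ts)   = cong (λ C → μ k C (subTs σ ts)) (subF-dual (liftS k σ) B)

  -- Predicate variables

  renP-cong : {ρ ρ′ : PRen Δ Δ′} → (∀ {k} (x : PVar Δ k) → ρ x ≡ ρ′ x) →
              (A : Formula Δ n) → renP ρ A ≡ renP ρ′ A
  liftPR-cong : {ρ ρ′ : PRen Δ Δ′} → (∀ {k} (x : PVar Δ k) → ρ x ≡ ρ′ x) →
                ∀ {k} (x : PVar (j ∷ Δ) k) → liftPR ρ x ≡ liftPR ρ′ x
  liftPR-cong e pz     = refl
  liftPR-cong e (ps x) = cong ps (e x)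

  renP-cong e (atom a ts)  = refl
  renP-cong e (natom a ts) = refl
  renP-cong e (pvar x ts)  = cong (λ y → pvar y ts) (e x)
  renP-cong e (A ⊗ B)      = cong₂ _⊗_ (renP-cong e A) (renP-cong e B)
  renP-cong e (A ⅋ B)      = cong₂ _⅋_ (renP-cong e A) (renP-cong e B)
  renP-cong e (A ⊕ B)      = cong₂ _⊕_ (renP-cong e A) (renP-cong e B)
  renP-cong e (A & B)      = cong₂ _&_ (renP-cong e A) (renP-cong e B)
  renP-cong e 𝟏            = refl
  renP-cong e ⊥ₗ           = refl
  renP-cong e 𝟎            = refl
  renP-cong e ⊤ₗ           = refl
  renP-cong e (Forall A)   = cong Forall (renP-cong e A)
  renP-cong e (Exists A)   = cong Exists (renP-cong e A)
  renP-cong e (s ≐ t)      = refl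
  renP-cong e (s ≠ t)      = refl
  renP-cong e (μ k B ts)   = cong (λ C → μ k C ts) (renP-cong (liftPR-cong e) B)
  renP-cong e (ν k B ts)   = cong (λ C → ν k C ts) (renP-cong (liftPR-cong e) B)

  renP-∘ : (ρ′ : PRen Δ′ Δ″) (ρ : PRen Δ Δ′) (A : Formula Δ n) →
           renP ρ′ (renP ρ A) ≡ renP (λ x → ρ′ (ρ x)) A
  renP-∘ ρ′ ρ (atom a ts)  = refl
  renP-∘ ρ′ ρ (natom a ts) = refl
  renP-∘ ρ′ ρ (pvar x ts)  = refl
  renP-∘ ρ′ ρ (A ⊗ B)      = cong₂ _⊗_ (renP-∘ ρ′ ρ A) (renP-∘ ρ′ ρ B)
  renP-∘ ρ′ ρ (A ⅋ B)      = cong₂ _⅋_ (renP-∘ ρ′ ρ A) (renP-∘ ρ′ ρ B)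
  renP-∘ ρ′ ρ (A ⊕ B)      = cong₂ _⊕_ (renP-∘ ρ′ ρ A) (renP-∘ ρ′ ρ B)
  renP-∘ ρ′ ρ (A & B)      = cong₂ _&_ (renP-∘ ρ′ ρ A) (renP-∘ ρ′ ρ B)
  renP-∘ ρ′ ρ 𝟏            = refl
  renP-∘ ρ′ ρ ⊥ₗ           = refl
  renP-∘ ρ′ ρ 𝟎            = refl
  renP-∘ ρ′ ρ ⊤ₗ           = refl
  renP-∘ ρ′ ρ (Forall A)   = cong Forall (renP-∘ ρ′ ρ A)
  renP-∘ ρ′ ρ (Exists A)   = cong Exists (renP-∘ ρ′ ρ A)
  renP-∘ ρ′ ρ (s ≐ t)      = refl
  renP-∘ ρ′ ρ (s ≠ t)      = refl
  renP-∘ ρ′ ρ (μ k B ts) =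
    cong (λ C → μ k C ts) (trans (renP-∘ (liftPR ρ′) (liftPR ρ) B)
      (renP-cong (λ { pz → refl ; (ps x) → refl }) B))
  renP-∘ ρ′ ρ (ν k B ts) =
    cong (λ C → ν k C ts) (trans (renP-∘ (liftPR ρ′) (liftPR ρ) B)
      (renP-cong (λ { pz → refl ; (ps x) → refl }) B))

  subF-renP : (θ : Sub n m) (ρ : PRen Δ Δ′) (A : Formula Δ n) →
              subF θ (renP ρ A) ≡ renP ρ (subF θ A)
  subF-renP θ ρ (atom a ts)  = refl
  subF-renP θ ρ (natom a ts) = refl
  subF-renP θ ρ (pvar x ts)  = refl
  subF-renP θ ρ (A ⊗ B)      = cong₂ _⊗_ (subF-renP θ ρ A) (subF-renP θ ρ B)
  subF-renP θ ρ (A ⅋ B)      = cong₂ _⅋_ (subF-renP θ ρ A) (subF-renP θ ρ B)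
  subF-renP θ ρ (A ⊕ B)      = cong₂ _⊕_ (subF-renP θ ρ A) (subF-renP θ ρ B)
  subF-renP θ ρ (A & B)      = cong₂ _&_ (subF-renP θ ρ A) (subF-renP θ ρ B)
  subF-renP θ ρ 𝟏            = refl
  subF-renP θ ρ ⊥ₗ           = refl
  subF-renP θ ρ 𝟎            = refl
  subF-renP θ ρ ⊤ₗ           = refl
  subF-renP θ ρ (Forall A)   = cong Forall (subF-renP (liftS 1 θ) ρ A)
  subF-renP θ ρ (Exists A)   = cong Exists (subF-renP (liftS 1 θ) ρ A)
  subF-renP θ ρ (s ≐ t)      = refl
  subF-renP θ ρ (s ≠ t)      = refl
  subF-renP θ ρ (μ k B ts)   = cong (λ C → μ k C (subTs θ ts)) (subF-renP (liftS k θ) (liftPR ρ) B)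
  subF-renP θ ρ (ν k B ts)   = cong (λ C → ν k C (subTs θ ts)) (subF-renP (liftS k θ) (liftPR ρ) B)

  renF-renP : (r : Ren n m) (ρ : PRen Δ Δ′) (A : Formula Δ n) →
              renF r (renP ρ A) ≡ renP ρ (renF r A)
  renF-renP r ρ A = begin
    renF r (renP ρ A)           ≡⟨ renF≡subF r (renP ρ A) ⟩
    subF (var ∘ r) (renP ρ A)   ≡⟨ subF-renP (var ∘ r) ρ A ⟩
    renP ρ (subF (var ∘ r) A)   ≡⟨ cong (renP ρ) (renF≡subF r A) ⟨
    renP ρ (renF r A)           ∎

  subP-cong : {σ τ : PSub Δ Δ′ n} → (∀ {k} (x : PVar Δ k) → σ x ≡ τ x) →
              (A : Formula Δ n) → subP σ A ≡ subP τ A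

  psubUnderμ-cong : ∀ j {σ τ : PSub Δ Δ′ n} → (∀ {k} (x : PVar Δ k) → σ x ≡ τ x) →
                    ∀ {k} (x : PVar (j ∷ Δ) k) → psubUnderμ j σ x ≡ psubUnderμ j τ x
  psubUnderμ-cong j e pz         = refl
  psubUnderμ-cong j e {k} (ps x) = cong (λ A → renP ps (renF (liftR k (j ↑ʳ_)) A)) (e x)

  subP-cong e (atom a ts)  = refl
  subP-cong e (natom a ts) = refl
  subP-cong e (pvar x ts)  = cong (subF (inst ts)) (e x)
  subP-cong e (A ⊗ B)      = cong₂ _⊗_ (subP-cong e A) (subP-cong e B)
  subP-cong e (A ⅋ B)      = cong₂ _⅋_ (subP-cong e A) (subP-cong e B)
  subP-cong e (A ⊕ B)      = cong₂ _⊕_ (subP-cong e A) (subP-cong e B)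
  subP-cong e (A & B)      = cong₂ _&_ (subP-cong e A) (subP-cong e B)
  subP-cong e 𝟏            = refl
  subP-cong e ⊥ₗ           = refl
  subP-cong e 𝟎            = refl
  subP-cong e ⊤ₗ           = refl
  subP-cong e (Forall A)   = cong Forall (subP-cong (λ {k} x → cong (renF (liftR k suc)) (e x)) A)
  subP-cong e (Exists A)   = cong Exists (subP-cong (λ {k} x → cong (renF (liftR k suc)) (e x)) A)
  subP-cong e (s ≐ t)      = refl
  subP-cong e (s ≠ t)      = refl
  subP-cong e (μ k B ts)   = cong (λ C → μ k C ts) (subP-cong (psubUnderμ-cong k e) B)
  subP-cong e (ν k B ts)   = cong (λ C → ν k C ts) (subP-cong (psubUnderμ-cong k e) B)

  subP-renP : (τ : PSub Δ′ Δ″ n) (ρ : PRen Δ Δ′) (A : Formula Δ n) →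
              subP τ (renP ρ A) ≡ subP (λ x → τ (ρ x)) A
  subP-renP τ ρ (atom a ts)  = refl
  subP-renP τ ρ (natom a ts) = refl
  subP-renP τ ρ (pvar x ts)  = refl
  subP-renP τ ρ (A ⊗ B)      = cong₂ _⊗_ (subP-renP τ ρ A) (subP-renP τ ρ B)
  subP-renP τ ρ (A ⅋ B)      = cong₂ _⅋_ (subP-renP τ ρ A) (subP-renP τ ρ B)
  subP-renP τ ρ (A ⊕ B)      = cong₂ _⊕_ (subP-renP τ ρ A) (subP-renP τ ρ B)
  subP-renP τ ρ (A & B)      = cong₂ _&_ (subP-renP τ ρ A) (subP-renP τ ρ B)
  subP-renP τ ρ 𝟏            = refl
  subP-renP τ ρ ⊥ₗ           = refl
  subP-renP τ ρ 𝟎            = refl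
  subP-renP τ ρ ⊤ₗ           = refl
  subP-renP τ ρ (Forall A)   = cong Forall (subP-renP (psubUnder∀ τ) ρ A)
  subP-renP τ ρ (Exists A)   = cong Exists (subP-renP (psubUnder∀ τ) ρ A)
  subP-renP τ ρ (s ≐ t)      = refl
  subP-renP τ ρ (s ≠ t)      = refl
  subP-renP τ ρ (μ k B ts) =
    cong (λ C → μ k C ts) (trans (subP-renP (psubUnderμ k τ) (liftPR ρ) B)
      (subP-cong (λ { pz → refl ; (ps x) → refl }) B))
  subP-renP τ ρ (ν k B ts) =
    cong (λ C → ν k C ts) (trans (subP-renP (psubUnderμ k τ) (liftPR ρ) B)
      (subP-cong (λ { pz → refl ; (ps x) → refl }) B))

  renP-subP : (ρ : PRen Δ′ Δ″) (σ : PSub Δ Δ′ n) (A : Formula Δ n) →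
              renP ρ (subP σ A) ≡ subP (λ x → renP ρ (σ x)) A

  renP-psubUnderμ : ∀ j (ρ : PRen Δ′ Δ″) (σ : PSub Δ Δ′ n) {k} (x : PVar (j ∷ Δ) k) →
                    renP (liftPR ρ) (psubUnderμ j σ x) ≡ psubUnderμ j (λ y → renP ρ (σ y)) x
  renP-psubUnderμ j ρ σ pz         = refl
  renP-psubUnderμ j ρ σ {k} (ps x) = begin
    renP (liftPR ρ) (renP ps (renF r (σ x))) ≡⟨ renP-∘ (liftPR ρ) ps (renF r (σ x)) ⟩
    renP (λ y → ps (ρ y)) (renF r (σ x))     ≡⟨ renP-∘ ps ρ (renF r (σ x)) ⟨
    renP ps (renP ρ (renF r (σ x)))          ≡⟨ cong (renP ps) (renF-renP r ρ (σ x)) ⟨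
    renP ps (renF r (renP ρ (σ x)))          ∎
    where r = liftR k (j ↑ʳ_)

  renP-subP ρ σ (atom a ts)  = refl
  renP-subP ρ σ (natom a ts) = refl
  renP-subP ρ σ (pvar x ts)  = sym (subF-renP (inst ts) ρ (σ x))
  renP-subP ρ σ (A ⊗ B)      = cong₂ _⊗_ (renP-subP ρ σ A) (renP-subP ρ σ B)
  renP-subP ρ σ (A ⅋ B)      = cong₂ _⅋_ (renP-subP ρ σ A) (renP-subP ρ σ B)
  renP-subP ρ σ (A ⊕ B)      = cong₂ _⊕_ (renP-subP ρ σ A) (renP-subP ρ σ B)
  renP-subP ρ σ (A & B)      = cong₂ _&_ (renP-subP ρ σ A) (renP-subP ρ σ B)
  renP-subP ρ σ 𝟏            = refl
  renP-subP ρ σ ⊥ₗ           = refl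
  renP-subP ρ σ 𝟎            = refl
  renP-subP ρ σ ⊤ₗ           = refl
  renP-subP ρ σ (Forall A) =
    cong Forall (trans (renP-subP ρ (psubUnder∀ σ) A)
      (subP-cong (λ {k} x → sym (renF-renP (liftR k suc) ρ (σ x))) A))
  renP-subP ρ σ (Exists A) =
    cong Exists (trans (renP-subP ρ (psubUnder∀ σ) A)
      (subP-cong (λ {k} x → sym (renF-renP (liftR k suc) ρ (σ x))) A))
  renP-subP ρ σ (s ≐ t)      = refl
  renP-subP ρ σ (s ≠ t)      = refl
  renP-subP ρ σ (μ k B ts) =
    cong (λ C → μ k C ts) (trans (renP-subP (liftPR ρ) (psubUnderμ k σ) B)
      (subP-cong (renP-psubUnderμ k ρ σ) B))
  renP-subP ρ σ (ν k B ts) =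
    cong (λ C → ν k C ts) (trans (renP-subP (liftPR ρ) (psubUnderμ k σ) B)
      (subP-cong (renP-psubUnderμ k ρ σ) B))

  subF-renF-lift : ∀ k j (θ : Sub n m) (A : Formula Δ (k + n)) →
                   subF (liftS k (liftS j θ)) (renF (liftR k (j ↑ʳ_)) A) ≡
                   renF (liftR k (j ↑ʳ_)) (subF (liftS k θ) A)
  subF-renF-lift k j θ A = begin
    subF (liftS k (liftS j θ)) (renF (liftR k (j ↑ʳ_)) A)
      ≡⟨ cong (subF (liftS k (liftS j θ))) (renF-liftR≡subF k (j ↑ʳ_) A) ⟩
    subF (liftS k (liftS j θ)) (subF (liftS k (wk j)) A)
      ≡⟨ subF-square (liftS-square k (liftS-wk j θ)) A ⟩
    subF (liftS k (wk j)) (subF (liftS k θ) A)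
      ≡⟨ renF-liftR≡subF k (j ↑ʳ_) (subF (liftS k θ) A) ⟨
    renF (liftR k (j ↑ʳ_)) (subF (liftS k θ) A)           ∎

  infixr 9 _⊙_
  _⊙_ : Sub n m → PSub Δ Δ′ n → PSub Δ Δ′ m
  (θ ⊙ σ) {k} x = subF (liftS k θ) (σ x)

  ⊙-psubUnderμ : ∀ j (θ : Sub n m) (σ : PSub Δ Δ′ n) {k} (x : PVar (j ∷ Δ) k) →
                 (liftS j θ ⊙ psubUnderμ j σ) x ≡ psubUnderμ j (θ ⊙ σ) x
  ⊙-psubUnderμ j θ σ pz = cong (pvar pz) (subTs-liftS-vars j (liftS j θ))
  ⊙-psubUnderμ j θ σ {k} (ps x) =
    trans (subF-renP (liftS k (liftS j θ)) ps (renF (liftR k (j ↑ʳ_)) (σ x)))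
          (cong (renP ps) (subF-renF-lift k j θ (σ x)))

  subF-subP : (θ : Sub n m) (σ : PSub Δ Δ′ n) (A : Formula Δ n) →
              subF θ (subP σ A) ≡ subP (θ ⊙ σ) (subF θ A)
  subF-subP θ σ (atom a ts)  = refl
  subF-subP θ σ (natom a ts) = refl
  subF-subP θ σ (pvar x ts)  = subF-inst θ ts (σ x)
  subF-subP θ σ (A ⊗ B)      = cong₂ _⊗_ (subF-subP θ σ A) (subF-subP θ σ B)
  subF-subP θ σ (A ⅋ B)      = cong₂ _⅋_ (subF-subP θ σ A) (subF-subP θ σ B)
  subF-subP θ σ (A ⊕ B)      = cong₂ _⊕_ (subF-subP θ σ A) (subF-subP θ σ B)
  subF-subP θ σ (A & B)      = cong₂ _&_ (subF-subP θ σ A) (subF-subP θ σ B)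
  subF-subP θ σ 𝟏            = refl
  subF-subP θ σ ⊥ₗ           = refl
  subF-subP θ σ 𝟎            = refl
  subF-subP θ σ ⊤ₗ           = refl
  subF-subP θ σ (Forall A) =
    cong Forall (trans (subF-subP (liftS 1 θ) (psubUnder∀ σ) A)
      (subP-cong (λ {k} x → subF-renF-lift k 1 θ (σ x)) (subF (liftS 1 θ) A)))
  subF-subP θ σ (Exists A) =
    cong Exists (trans (subF-subP (liftS 1 θ) (psubUnder∀ σ) A)
      (subP-cong (λ {k} x → subF-renF-lift k 1 θ (σ x)) (subF (liftS 1 θ) A)))
  subF-subP θ σ (s ≐ t)      = refl
  subF-subP θ σ (s ≠ t)      = refl
  subF-subP θ σ (μ k B ts) =
    cong (λ C → μ k C (subTs θ ts)) (trans (subF-subP (liftS k θ) (psubUnderμ k σ) B)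
      (subP-cong (⊙-psubUnderμ k θ σ) (subF (liftS k θ) B)))
  subF-subP θ σ (ν k B ts) =
    cong (λ C → ν k C (subTs θ ts)) (trans (subF-subP (liftS k θ) (psubUnderμ k σ) B)
      (subP-cong (⊙-psubUnderμ k θ σ) (subF (liftS k θ) B)))

  wkP : ∀ k → PSub Δ Δ′ n → PSub Δ Δ′ (k + n)
  wkP k τ {l} x = renF (liftR l (k ↑ʳ_)) (τ x)

  infixr 9 _∘ₚ_
  _∘ₚ_ : PSub Δ′ Δ″ n → PSub Δ Δ′ n → PSub Δ Δ″ n
  (τ ∘ₚ σ) {k} x = subP (wkP k τ) (σ x)

  subF-inst-wk : ∀ l (ts : Vec (Term n) k) (A : Formula Δ (l + n)) →
                 subF (liftS l (inst ts)) (renF (liftR l (k ↑ʳ_)) A) ≡ A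
  subF-inst-wk {k = k} l ts A = begin
    subF (liftS l (inst ts)) (renF (liftR l (k ↑ʳ_)) A)
      ≡⟨ cong (subF (liftS l (inst ts))) (renF-liftR≡subF l (k ↑ʳ_) A) ⟩
    subF (liftS l (inst ts)) (subF (liftS l (wk k)) A)  ≡⟨ subF-liftS-∘ l (inst ts) (wk k) A ⟩
    subF (liftS l (inst ts ∘ₛ wk k)) A                  ≡⟨ subF-liftS-id l (inst-↑ʳ ts) A ⟩
    A                                                   ∎

  subF-inst-vars : ∀ k (A : Formula Δ (k + n)) →
                   subF (inst (vars k n)) (renF (liftR k (k ↑ʳ_)) A) ≡ A
  subF-inst-vars {n = n} k A = begin
    subF (inst (vars k n)) (renF (liftR k (k ↑ʳ_)) A)
      ≡⟨ cong (subF (inst (vars k n))) (renF-liftR≡subF k (k ↑ʳ_) A) ⟩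
    subF (inst (vars k n)) (subF (liftS k (wk k)) A)  ≡⟨ subF-∘ _ _ A ⟩
    subF (inst (vars k n) ∘ₛ liftS k (wk k)) A        ≡⟨ subF-id (inst-vars k n) A ⟩
    A                                                 ∎

  renF-subP : ∀ k j (τ : PSub Δ Δ′ n) (A : Formula Δ (k + n)) →
              renF (liftR k (j ↑ʳ_)) (subP (wkP k τ) A) ≡ subP (wkP k (wkP j τ)) (renF (liftR k (j ↑ʳ_)) A)
  renF-subP k j τ A = begin
    renF (liftR k (j ↑ʳ_)) (subP (wkP k τ) A)                       ≡⟨ renF-liftR≡subF k (j ↑ʳ_) _ ⟩
    subF θ (subP (wkP k τ) A)                                       ≡⟨ subF-subP θ (wkP k τ) A ⟩
    subP (θ ⊙ wkP k τ) (subF θ A)                                   ≡⟨ subP-cong eq (subF θ A) ⟩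
    subP (wkP k (wkP j τ)) (subF θ A)
      ≡⟨ cong (subP (wkP k (wkP j τ))) (renF-liftR≡subF k (j ↑ʳ_) A) ⟨
    subP (wkP k (wkP j τ)) (renF (liftR k (j ↑ʳ_)) A)               ∎
    where
    θ = liftS k (wk j)
    eq : ∀ {l} x → (θ ⊙ wkP k τ) {l} x ≡ wkP k (wkP j τ) x
    eq {l} x = trans (subF-renF-lift l k (wk j) (τ x))
                     (cong (renF (liftR l (k ↑ʳ_))) (sym (renF-liftR≡subF l (j ↑ʳ_) (τ x))))

  ∘ₚ-psubUnderμ : ∀ j (τ : PSub Δ′ Δ″ n) (σ : PSub Δ Δ′ n) {k} (x : PVar (j ∷ Δ) k) →
                  (psubUnderμ j τ ∘ₚ psubUnderμ j σ) x ≡ psubUnderμ j (τ ∘ₚ σ) x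
  ∘ₚ-psubUnderμ {n = n} j τ σ pz = cong (pvar pz) (begin
    subTs (inst xs) (renTs (liftR j (j ↑ʳ_)) xs)       ≡⟨ cong (subTs (inst xs)) (renTs≡subTs _ xs) ⟩
    subTs (inst xs) (subTs (var ∘ liftR j (j ↑ʳ_)) xs)
      ≡⟨ cong (subTs (inst xs)) (subTs-cong (liftS-ren j (j ↑ʳ_)) xs) ⟨
    subTs (inst xs) (subTs (liftS j (wk j)) xs)        ≡⟨ subTs-∘ _ _ xs ⟩
    subTs (inst xs ∘ₛ liftS j (wk j)) xs               ≡⟨ subTs-id (inst-vars j (j + n)) xs ⟩
    xs                                                 ∎)
    where xs = vars j (j + n)
  ∘ₚ-psubUnderμ j τ σ {k} (ps x) = begin
    subP (wkP k (psubUnderμ j τ)) (renP ps (renF r (σ x)))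
      ≡⟨ subP-renP (wkP k (psubUnderμ j τ)) ps (renF r (σ x)) ⟩
    subP (λ y → wkP k (psubUnderμ j τ) (ps y)) (renF r (σ x))
      ≡⟨ subP-cong (λ {l} y → renF-renP (liftR l (k ↑ʳ_)) ps _) (renF r (σ x)) ⟩
    subP (λ y → renP ps (wkP k (wkP j τ) y)) (renF r (σ x))
      ≡⟨ renP-subP ps (wkP k (wkP j τ)) (renF r (σ x)) ⟨
    renP ps (subP (wkP k (wkP j τ)) (renF r (σ x)))
      ≡⟨ cong (renP ps) (renF-subP k j τ (σ x)) ⟨
    renP ps (renF r (subP (wkP k τ) (σ x)))                    ∎
    where r = liftR k (j ↑ʳ_)

  subP-∘ : (τ : PSub Δ′ Δ″ n) (σ : PSub Δ Δ′ n) (A : Formula Δ n) →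
           subP τ (subP σ A) ≡ subP (τ ∘ₚ σ) A

  subP-∘-pvar : (τ : PSub Δ′ Δ″ n) (A : Formula Δ′ (k + n)) (ts : Vec (Term n) k) →
                subP τ (subF (inst ts) A) ≡ subF (inst ts) (subP (wkP k τ) A)
  subP-∘-pvar {k = k} τ A ts = sym (trans (subF-subP (inst ts) (wkP k τ) A)
    (subP-cong (λ {l} x → subF-inst-wk l ts (τ x)) (subF (inst ts) A)))

  subP-∘ τ σ (atom a ts)  = refl
  subP-∘ τ σ (natom a ts) = refl
  subP-∘ τ σ (pvar x ts)  = subP-∘-pvar τ (σ x) ts
  subP-∘ τ σ (A ⊗ B)      = cong₂ _⊗_ (subP-∘ τ σ A) (subP-∘ τ σ B)
  subP-∘ τ σ (A ⅋ B)      = cong₂ _⅋_ (subP-∘ τ σ A) (subP-∘ τ σ B)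
  subP-∘ τ σ (A ⊕ B)      = cong₂ _⊕_ (subP-∘ τ σ A) (subP-∘ τ σ B)
  subP-∘ τ σ (A & B)      = cong₂ _&_ (subP-∘ τ σ A) (subP-∘ τ σ B)
  subP-∘ τ σ 𝟏            = refl
  subP-∘ τ σ ⊥ₗ           = refl
  subP-∘ τ σ 𝟎            = refl
  subP-∘ τ σ ⊤ₗ           = refl
  subP-∘ τ σ (Forall A) =
    cong Forall (trans (subP-∘ (psubUnder∀ τ) (psubUnder∀ σ) A)
      (subP-cong (λ {k} x → sym (renF-subP k 1 τ (σ x))) A))
  subP-∘ τ σ (Exists A) =
    cong Exists (trans (subP-∘ (psubUnder∀ τ) (psubUnder∀ σ) A)
      (subP-cong (λ {k} x → sym (renF-subP k 1 τ (σ x))) A))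
  subP-∘ τ σ (s ≐ t)      = refl
  subP-∘ τ σ (s ≠ t)      = refl
  subP-∘ τ σ (μ k B ts) =
    cong (λ C → μ k C ts) (trans (subP-∘ (psubUnderμ k τ) (psubUnderμ k σ) B)
      (subP-cong (∘ₚ-psubUnderμ k τ σ) B))
  subP-∘ τ σ (ν k B ts) =
    cong (λ C → ν k C ts) (trans (subP-∘ (psubUnderμ k τ) (psubUnderμ k σ) B)
      (subP-cong (∘ₚ-psubUnderμ k τ σ) B))

  subP-id : {σ : PSub Δ Δ n} → (∀ {k} (x : PVar Δ k) → σ x ≡ pvar x (vars k n)) →
            (A : Formula Δ n) → subP σ A ≡ A

  renF-pvar-vars : ∀ j {k} (x : PVar Δ k) →
                   renF (liftR k (j ↑ʳ_)) (pvar x (vars k n)) ≡ pvar x (vars k (j + n))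
  renF-pvar-vars j {k} x = trans (renF-liftR≡subF k (j ↑ʳ_) _) (cong (pvar x) (subTs-liftS-vars k (wk j)))

  psubUnderμ-id : ∀ j {σ : PSub Δ Δ n} → (∀ {k} (x : PVar Δ k) → σ x ≡ pvar x (vars k n)) →
                  ∀ {k} (x : PVar (j ∷ Δ) k) → psubUnderμ j σ x ≡ pvar x (vars k (j + n))
  psubUnderμ-id j e pz         = refl
  psubUnderμ-id j e {k} (ps x) =
    trans (cong (λ A → renP ps (renF (liftR k (j ↑ʳ_)) A)) (e x)) (cong (renP ps) (renF-pvar-vars j x))

  subP-id e (atom a ts)  = refl
  subP-id e (natom a ts) = refl
  subP-id e (pvar x ts)  = trans (cong (subF (inst ts)) (e x)) (cong (pvar x) (subTs-inst-vars ts))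
  subP-id e (A ⊗ B)      = cong₂ _⊗_ (subP-id e A) (subP-id e B)
  subP-id e (A ⅋ B)      = cong₂ _⅋_ (subP-id e A) (subP-id e B)
  subP-id e (A ⊕ B)      = cong₂ _⊕_ (subP-id e A) (subP-id e B)
  subP-id e (A & B)      = cong₂ _&_ (subP-id e A) (subP-id e B)
  subP-id e 𝟏            = refl
  subP-id e ⊥ₗ           = refl
  subP-id e 𝟎            = refl
  subP-id e ⊤ₗ           = refl
  subP-id e (Forall A) =
    cong Forall (subP-id (λ {k} x → trans (cong (renF (liftR k suc)) (e x)) (renF-pvar-vars 1 x)) A)
  subP-id e (Exists A) =
    cong Exists (subP-id (λ {k} x → trans (cong (renF (liftR k suc)) (e x)) (renF-pvar-vars 1 x)) A)
  subP-id e (s ≐ t)      = refl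
  subP-id e (s ≠ t)      = refl
  subP-id e (μ k B ts)   = cong (λ C → μ k C ts) (subP-id (psubUnderμ-id k e) B)
  subP-id e (ν k B ts)   = cong (λ C → ν k C ts) (subP-id (psubUnderμ-id k e) B)

  Async : List (Item n) → List (Formula [] n) → Set₁
  Async = D.Async 𝕊
  Focus : List (Item n) → Formula [] n → Set₁
  Focus = D.Focus 𝕊
  isSync isAsync : Formula Δ n → Set
  isSync  = D.isSync 𝕊
  isAsync = D.isAsync 𝕊
  subI : Sub n m → Item n → Item m
  subI = D.subI 𝕊
  renI : Ren n m → Item n → Item m
  renI = D.renI 𝕊
  Deriv : List (Formula [] n) → Set₁
  Deriv = D.Deriv 𝕊
  CutFree : {Γ : List (Formula [] n)} → Deriv Γ → Set
  CutFree = D.CutFree 𝕊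
  CSU : Term n → Term n → Set₁
  CSU = D.CSU 𝕊

  variable
    Ξ Ξ′ Φ Φ′ : List (Item n)
    Ω Ω′ Γ Γ′ : List (Formula [] n)
    P Q A B : Formula [] n

  -- Fixed points applied to generic arguments

  weakenBody : ∀ k → Formula Δ (k + n) → Formula Δ (k + (k + n))
  weakenBody k = renF (liftR k (k ↑ʳ_))

  μx νx : ∀ k → Formula (k ∷ []) (k + n) → Formula [] (k + n)
  μx {n = n} k B = μ k (weakenBody k B) (vars k n)
  νx {n = n} k B = ν k (weakenBody k B) (vars k n)

  subF-applyB : ∀ k (θ : Sub n m) (B : Formula (k ∷ []) (k + n)) (S : Formula [] (k + n)) →
                subF (liftS k θ) (applyB k B S) ≡ applyB k (subF (liftS k θ) B) (subF (liftS k θ) S)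
  subF-applyB k θ B S = trans (subF-subP (liftS k θ) _ B)
    (subP-cong (λ { pz → subF-renF-lift k k θ S ; (ps ()) }) (subF (liftS k θ) B))

  subF-μx : ∀ k (θ : Sub n m) (B : Formula (k ∷ []) (k + n)) →
            subF (liftS k θ) (μx k B) ≡ μx k (subF (liftS k θ) B)
  subF-μx k θ B = cong₂ (μ k) (subF-renF-lift k k θ B) (subTs-liftS-vars k θ)

  applyS-νx : ∀ k (B : Formula (k ∷ []) (k + n)) (ts : Vec (Term n) k) →
              applyS (νx k B) ts ≡ ν k B ts
  applyS-νx k B ts = cong₂ (ν k) (subF-inst-wk k ts B) (subTs-inst-vars ts)

  dual-weakenBody : ∀ k (B : Formula Δ (k + n)) → dual (weakenBody k B) ≡ weakenBody k (dual B)
  dual-weakenBody k B = begin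
    dual (weakenBody k B)           ≡⟨ cong dual (renF-liftR≡subF k _ B) ⟩
    dual (subF (liftS k (wk k)) B)  ≡⟨ subF-dual (liftS k (wk k)) B ⟨
    subF (liftS k (wk k)) (dual B)  ≡⟨ renF-liftR≡subF k _ (dual B) ⟨
    weakenBody k (dual B)           ∎

  dual-νx : ∀ k (B : Formula (k ∷ []) (k + n)) → dual (νx k B) ≡ μx k (dual B)
  dual-νx {n = n} k B = cong (λ C → μ k C (vars k n)) (dual-weakenBody k B)

  unfoldμ≡applyB : ∀ k (B : Formula (k ∷ []) (k + n)) (ts : Vec (Term n) k) →
                   unfoldμ k B ts ≡ applyS (applyB k B (μx k B)) ts
  unfoldμ≡applyB {n = n} k B ts = cong (subF (inst ts)) (subP-cong (λ { pz → sym eq ; (ps ()) }) B)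
    where
    eq : weakenBody k (μx k B) ≡ μ k (renF (liftR k (λ i → k ↑ʳ (k ↑ʳ i))) B) (vars k (k + n))
    eq = begin
      weakenBody k (μx k B)             ≡⟨ renF-liftR≡subF k _ (μx k B) ⟩
      subF (liftS k (wk k)) (μx k B)    ≡⟨ subF-μx k (wk k) B ⟩
      μx k (subF (liftS k (wk k)) B)    ≡⟨ cong (λ C → μ k C (vars k (k + n))) (begin
        weakenBody k (subF (liftS k (wk k)) B)            ≡⟨ renF-liftR≡subF k _ _ ⟩
        subF (liftS k (wk k)) (subF (liftS k (wk k)) B)   ≡⟨ subF-liftS-∘ k (wk k) (wk k) B ⟩
        subF (liftS k (wk k ∘ₛ wk k)) B                   ≡⟨ renF-liftR≡subF k _ B ⟨
        renF (liftR k (λ i → k ↑ʳ (k ↑ʳ i))) B            ∎) ⟩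
      μ k (renF (liftR k (λ i → k ↑ʳ (k ↑ʳ i))) B) (vars k (k + n)) ∎

  subF-applyB-μx : ∀ k (θ : Sub n m) (B : Formula (k ∷ []) (k + n)) →
                   subF (liftS k θ) (applyB k B (μx k B)) ≡
                   applyB k (subF (liftS k θ) B) (μx k (subF (liftS k θ) B))
  subF-applyB-μx k θ B =
    trans (subF-applyB k θ B (μx k B)) (cong (applyB k (subF (liftS k θ) B)) (subF-μx k θ B))

  subF-unfoldμ : ∀ k (θ : Sub n m) (B : Formula (k ∷ []) (k + n)) (ts : Vec (Term n) k) →
                 subF θ (unfoldμ k B ts) ≡ unfoldμ k (subF (liftS k θ) B) (subTs θ ts)
  subF-unfoldμ k θ B ts = begin
    subF θ (unfoldμ k B ts)                                    ≡⟨ cong (subF θ) (unfoldμ≡applyB k B ts) ⟩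
    subF θ (applyS (applyB k B (μx k B)) ts)                   ≡⟨ subF-inst θ ts _ ⟩
    applyS (subF (liftS k θ) (applyB k B (μx k B))) (subTs θ ts)
      ≡⟨ cong (λ C → applyS C (subTs θ ts)) (subF-applyB-μx k θ B) ⟩
    applyS (applyB k (subF (liftS k θ) B) (μx k (subF (liftS k θ) B))) (subTs θ ts)
      ≡⟨ unfoldμ≡applyB k (subF (liftS k θ) B) (subTs θ ts) ⟨
    unfoldμ k (subF (liftS k θ) B) (subTs θ ts)                ∎

  unfoldμ-vars : ∀ k (B : Formula (k ∷ []) (k + n)) →
                 unfoldμ k (weakenBody k B) (vars k n) ≡ applyB k B (μx k B)
  unfoldμ-vars {n = n} k B = begin
    unfoldμ k (weakenBody k B) (vars k n)
      ≡⟨ unfoldμ≡applyB k (weakenBody k B) (vars k n) ⟩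
    applyS (applyB k (weakenBody k B) (μx k (weakenBody k B))) (vars k n)
      ≡⟨ cong (λ C → applyS (applyB k C (μx k C)) (vars k n)) (renF-liftR≡subF k _ B) ⟩
    applyS (applyB k (subF θ B) (μx k (subF θ B))) (vars k n)
      ≡⟨ cong (λ C → applyS C (vars k n)) (subF-applyB-μx k (wk k) B) ⟨
    applyS (subF θ (applyB k B (μx k B))) (vars k n)
      ≡⟨ cong (λ C → applyS C (vars k n)) (renF-liftR≡subF k _ _) ⟨
    applyS (weakenBody k (applyB k B (μx k B))) (vars k n)               ≡⟨ subF-inst-vars k _ ⟩
    applyB k B (μx k B)                                                  ∎
    where θ = liftS k (wk k)

  -- Substitution in focused derivations

  subΞ : Sub n m → List (Item n) → List (Item m)
  subΞ θ = map (subI θ)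

  subΩ : Sub n m → List (Formula [] n) → List (Formula [] m)
  subΩ θ = map (subF θ)

  subI-cong : {σ τ : Sub n m} → σ ≗ τ → (i : Item n) → subI σ i ≡ subI τ i
  subI-cong e ⟨ A ⟩ = cong ⟨_⟩ (subF-cong e A)
  subI-cong e (A *) = cong _* (subF-cong e A)

  subΞ-cong : {σ τ : Sub n m} → σ ≗ τ → (Ξ : List (Item n)) → subΞ σ Ξ ≡ subΞ τ Ξ
  subΞ-cong e = map-cong (subI-cong e)

  subΩ-cong : {σ τ : Sub n m} → σ ≗ τ → (Ω : List (Formula [] n)) → subΩ σ Ω ≡ subΩ τ Ω
  subΩ-cong e = map-cong (subF-cong e)

  subI-∘ : (τ : Sub m l) (σ : Sub n m) (i : Item n) → subI τ (subI σ i) ≡ subI (τ ∘ₛ σ) i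
  subI-∘ τ σ ⟨ A ⟩ = cong ⟨_⟩ (subF-∘ τ σ A)
  subI-∘ τ σ (A *) = cong _* (subF-∘ τ σ A)

  subΞ-∘ : (τ : Sub m l) (σ : Sub n m) (Ξ : List (Item n)) → subΞ τ (subΞ σ Ξ) ≡ subΞ (τ ∘ₛ σ) Ξ
  subΞ-∘ τ σ Ξ = trans (sym (map-∘ Ξ)) (map-cong (subI-∘ τ σ) Ξ)

  subΩ-∘ : (τ : Sub m l) (σ : Sub n m) (Ω : List (Formula [] n)) →
           subΩ τ (subΩ σ Ω) ≡ subΩ (τ ∘ₛ σ) Ω
  subΩ-∘ τ σ Ω = trans (sym (map-∘ Ω)) (map-cong (subF-∘ τ σ) Ω)

  subΞ-square : {τ : Sub m l} {σ : Sub n m} {τ′ : Sub j l} {σ′ : Sub n j} →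
                τ ∘ₛ σ ≗ τ′ ∘ₛ σ′ → (Ξ : List (Item n)) → subΞ τ (subΞ σ Ξ) ≡ subΞ τ′ (subΞ σ′ Ξ)
  subΞ-square e Ξ = trans (subΞ-∘ _ _ Ξ) (trans (subΞ-cong e Ξ) (sym (subΞ-∘ _ _ Ξ)))

  subΩ-square : {τ : Sub m l} {σ : Sub n m} {τ′ : Sub j l} {σ′ : Sub n j} →
                τ ∘ₛ σ ≗ τ′ ∘ₛ σ′ → (Ω : List (Formula [] n)) →
                                         subΩ τ (subΩ σ Ω) ≡ subΩ τ′ (subΩ σ′ Ω)
  subΩ-square e Ω = trans (subΩ-∘ _ _ Ω) (trans (subΩ-cong e Ω) (sym (subΩ-∘ _ _ Ω)))

  subI-var : (i : Item n) → subI var i ≡ i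
  subI-var ⟨ A ⟩ = cong ⟨_⟩ (subF-var A)
  subI-var (A *) = cong _* (subF-var A)

  subΞ-var : (Ξ : List (Item n)) → subΞ var Ξ ≡ Ξ
  subΞ-var Ξ = trans (map-cong subI-var Ξ) (map-id Ξ)

  subΩ-var : (Ω : List (Formula [] n)) → subΩ var Ω ≡ Ω
  subΩ-var Ω = trans (map-cong subF-var Ω) (map-id Ω)

  renI≡subI : (ρ : Ren n m) (i : Item n) → renI ρ i ≡ subI (var ∘ ρ) i
  renI≡subI ρ ⟨ A ⟩ = cong ⟨_⟩ (renF≡subF ρ A)
  renI≡subI ρ (A *) = cong _* (renF≡subF ρ A)

  renΞ≡subΞ : (ρ : Ren n m) (Ξ : List (Item n)) → map (renI ρ) Ξ ≡ subΞ (var ∘ ρ) Ξ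
  renΞ≡subΞ ρ = map-cong (renI≡subI ρ)

  renΩ≡subΩ : (ρ : Ren n m) (Ω : List (Formula [] n)) → map (renF ρ) Ω ≡ subΩ (var ∘ ρ) Ω
  renΩ≡subΩ ρ = map-cong (renF≡subF ρ)

  castA : Ξ ≡ Ξ′ → Ω ≡ Ω′ → Async Ξ Ω → Async Ξ′ Ω′
  castA refl refl d = d

  castF : Ξ ≡ Ξ′ → P ≡ Q → Focus Ξ P → Focus Ξ′ Q
  castF refl refl f = f

  isSync-subF : (θ : Sub n m) (P : Formula Δ n) → isSync P → isSync (subF θ P)
  isSync-subF θ (atom a ts)  p = tt
  isSync-subF θ (P ⊗ Q)      p = tt
  isSync-subF θ 𝟏            p = tt
  isSync-subF θ (P ⊕ Q)      p = tt
  isSync-subF θ 𝟎            p = tt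
  isSync-subF θ (Exists P)   p = tt
  isSync-subF θ (s ≐ t)      p = tt
  isSync-subF θ (μ k B ts)   p = tt

  isAsync-subF : (θ : Sub n m) (P : Formula Δ n) → isAsync P → isAsync (subF θ P)
  isAsync-subF θ (natom a ts) p = tt
  isAsync-subF θ (P ⅋ Q)      p = tt
  isAsync-subF θ ⊥ₗ           p = tt
  isAsync-subF θ (P & Q)      p = tt
  isAsync-subF θ ⊤ₗ           p = tt
  isAsync-subF θ (Forall P)   p = tt
  isAsync-subF θ (s ≠ t)      p = tt
  isAsync-subF θ (ν k B ts)   p = tt

  -- This trivial complete set exists without any unification algorithm, so
  -- derivations are closed under substitution for every signature.
  allUnifiers : (s t : Term n) → CSU s t
  allUnifiers {n} s t = record
    { Idx      = Σ ℕ λ m → Σ (Sub n m) λ θ → subT θ s ≡ subT θ t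
    ; ctx      = proj₁
    ; uni      = λ u → proj₁ (proj₂ u)
    ; unifies  = λ u → proj₂ (proj₂ u)
    ; complete = λ {m} θ e → (m , θ , e) , var , λ i → subT-var (θ i)
    }

  subT-unifier : (η : Sub m l) (θ : Sub n m) {s t : Term n} →
                 subT η (subT θ s) ≡ subT η (subT θ t) → subT (η ∘ₛ θ) s ≡ subT (η ∘ₛ θ) t
  subT-unifier η θ {s} {t} e = trans (sym (subT-∘ η θ s)) (trans e (subT-∘ η θ t))

  subΞ-suc : (θ : Sub n m) (Ξ : List (Item n)) →
             subΞ (liftS 1 θ) (map (renI suc) Ξ) ≡ map (renI suc) (subΞ θ Ξ)
  subΞ-suc θ Ξ = begin
    subΞ (liftS 1 θ) (map (renI suc) Ξ) ≡⟨ cong (subΞ (liftS 1 θ)) (renΞ≡subΞ suc Ξ) ⟩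
    subΞ (liftS 1 θ) (subΞ (wk 1) Ξ)    ≡⟨ subΞ-square (liftS-wk 1 θ) Ξ ⟩
    subΞ (wk 1) (subΞ θ Ξ)              ≡⟨ renΞ≡subΞ suc (subΞ θ Ξ) ⟨
    map (renI suc) (subΞ θ Ξ)           ∎

  subΩ-suc : (θ : Sub n m) (Ω : List (Formula [] n)) →
             subΩ (liftS 1 θ) (map (renF suc) Ω) ≡ map (renF suc) (subΩ θ Ω)
  subΩ-suc θ Ω = begin
    subΩ (liftS 1 θ) (map (renF suc) Ω) ≡⟨ cong (subΩ (liftS 1 θ)) (renΩ≡subΩ suc Ω) ⟩
    subΩ (liftS 1 θ) (subΩ (wk 1) Ω)    ≡⟨ subΩ-square (liftS-wk 1 θ) Ω ⟩
    subΩ (wk 1) (subΩ θ Ω)              ≡⟨ renΩ≡subΩ suc (subΩ θ Ω) ⟨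
    map (renF suc) (subΩ θ Ω)           ∎

  castCoinv : ∀ (θ : Sub n m) (B : Formula (k ∷ []) (k + n)) (S : Formula [] (k + n)) →
              Async [] (subF (liftS k θ) (applyB k B S) ∷ subF (liftS k θ) (dual S) ∷ []) →
              Async [] (applyB k (subF (liftS k θ) B) (subF (liftS k θ) S) ∷ dual (subF (liftS k θ) S) ∷ [])
  castCoinv θ B S = castA refl (cong₂ (λ X Y → X ∷ Y ∷ []) (subF-applyB _ θ B S) (subF-dual _ S))

  mutual
    subAsync : (θ : Sub n m) → Async Ξ Ω → Async (subΞ θ Ξ) (subΩ θ Ω)
    subAsync θ (exΞ p d)  = exΞ (map⁺ (subI θ) p) (subAsync θ d)
    subAsync θ (exΩ p d)  = exΩ (map⁺ (subF θ) p) (subAsync θ d)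
    subAsync θ (⅋a d)     = ⅋a (subAsync θ d)
    subAsync θ (⊥a d)     = ⊥a (subAsync θ d)
    subAsync θ (&a d e)   = &a (subAsync θ d) (subAsync θ e)
    subAsync θ ⊤a         = ⊤a
    subAsync θ (∀a {Ξ = Ξ} {Ω = Ω} d) =
      ∀a (castA (subΞ-suc θ Ξ) (cong (_ ∷_) (subΩ-suc θ Ω)) (subAsync (liftS 1 θ) d))
    subAsync θ (≠a {s = s} {t = t} {Ξ = Ξ} {Ω = Ω} c ds) = ≠a (allUnifiers _ _) λ where
      (_ , η , e) → let (u , ρ , q) = complete c (η ∘ₛ θ) (subT-unifier η θ {s} {t} e) in
        castA (subΞ-square q Ξ) (subΩ-square q Ω) (subAsync ρ (ds u))
    subAsync θ (νa {ts = ts} {Bd = B} S d e) =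
      νa (subF (liftS _ θ) S) (castA refl (cong (_∷ _) (subF-inst θ ts S)) (subAsync θ d))
         (castCoinv θ B S (subAsync (liftS _ θ) e))
    subAsync θ (νfrz d)   = νfrz (subAsync θ d)
    subAsync θ (nfrz d)   = nfrz (subAsync θ d)
    subAsync θ (store {P = P} p d) = store (isSync-subF θ P p) (subAsync θ d)
    subAsync θ (focus f)  = focus (subFocus θ f)

    subFocus : (θ : Sub n m) → Focus Ξ P → Focus (subΞ θ Ξ) (subF θ P)
    subFocus θ (exF p f)  = exF (map⁺ (subI θ) p) (subFocus θ f)
    subFocus θ (⊗s {Ξ = Ξ} {Ξ' = Ξ′} f g) =
      castF (sym (map-++ (subI θ) Ξ Ξ′)) refl (⊗s (subFocus θ f) (subFocus θ g))
    subFocus θ 𝟏s         = 𝟏s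
    subFocus θ (⊕s₁ f)    = ⊕s₁ (subFocus θ f)
    subFocus θ (⊕s₂ f)    = ⊕s₂ (subFocus θ f)
    subFocus θ (∃s {A = A} t f) = ∃s (subT θ t) (castF refl (subF-inst θ (t ∷ []) A) (subFocus θ f))
    subFocus θ (≐s t)     = ≐s (subT θ t)
    subFocus θ (μs {Bd = B} {ts = ts} f) = μs (castF refl (subF-unfoldμ _ θ B ts) (subFocus θ f))
    subFocus θ (μinit {Bd = B} {ts = ts}) =
      castF (cong (λ C → (ν _ C (subTs θ ts) *) ∷ []) (sym (subF-dual (liftS _ θ) B))) refl μinit
    subFocus θ ainit      = ainit
    subFocus θ (release {P = P} p d) = release (isAsync-subF θ P p) (subAsync θ d)

  -- Decompositions

  ∘ₛ-assoc : (ζ : Sub l j) (η : Sub m l) (θ : Sub n m) → (ζ ∘ₛ η) ∘ₛ θ ≗ ζ ∘ₛ (η ∘ₛ θ)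
  ∘ₛ-assoc ζ η θ i = sym (subT-∘ ζ η (θ i))

  subΞ-shifts : (ζ : Sub m l) (η : Sub n m) (Ξ₁ : List (Item m)) (Ξ₂ : List (Item l)) (Ξ : List (Item n)) →
                (subΞ ζ Ξ₁ ++ Ξ₂) ++ subΞ (ζ ∘ₛ η) Ξ ↭ Ξ₂ ++ subΞ ζ (Ξ₁ ++ subΞ η Ξ)
  subΞ-shifts ζ η Ξ₁ Ξ₂ Ξ = ↭-trans (↭-reflexive (++-assoc (subΞ ζ Ξ₁) Ξ₂ _))
    (↭-trans (shifts (subΞ ζ Ξ₁) Ξ₂)
    (↭-reflexive (cong (Ξ₂ ++_) (sym (trans (map-++ (subI ζ) Ξ₁ (subΞ η Ξ))
                                             (cong (subΞ ζ Ξ₁ ++_) (subΞ-∘ ζ η Ξ)))))))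

  Judgment : Set₂
  Judgment = ∀ {m} → List (Item m) → Formula [] m → Set₁

  Stable : Judgment → Set₁
  Stable V = ∀ {n m} (θ : Sub n m) {Ξ P} → V Ξ P → V (subΞ θ Ξ) (subF θ P)

  Cont : Judgment → Formula [] n → List (Item n) → List (Formula [] n) → Set₁
  Cont {n} V P Ξ Ω = ∀ {m} (η : Sub n m) {Ξ′} → V Ξ′ (subF η P) → Async (Ξ′ ++ subΞ η Ξ) (subΩ η Ω)

  -- Decomp V P Q: the asynchronous phase started on Q has only leaves at which
  -- the formula Q has become a list Ξ′ of items with V Ξ′ P, up to the
  -- substitutions performed by ∀ and ≠ during that phase.
  Decomp : Judgment → Formula [] n → Formula [] n → Set₁
  Decomp {n} V P Q = ∀ {m} (θ : Sub n m) {Ξ Ω} → Cont V (subF θ P) Ξ Ω → Async Ξ (subF θ Q ∷ Ω)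

  module _ {V : Judgment} where

    castV : Ξ ≡ Ξ′ → P ≡ Q → V Ξ P → V Ξ′ Q
    castV refl refl v = v

    Cont-now : Cont V P Ξ Ω → V Ξ′ P → Async (Ξ′ ++ Ξ) Ω
    Cont-now {P = P} {Ξ = Ξ} {Ω = Ω} k v =
      castA (cong (_ ++_) (subΞ-var Ξ)) (subΩ-var Ω) (k var (castV refl (sym (subF-var P)) v))

    Decomp-subF : (σ : Sub n m) (P Q : Formula [] n) → Decomp V P Q → Decomp V (subF σ P) (subF σ Q)
    Decomp-subF σ P Q f θ k = castA refl (cong (_∷ _) (sym (subF-∘ θ σ Q)))
      (f (θ ∘ₛ σ) (λ η v → k η (castV refl (cong (subF η) (sym (subF-∘ θ σ P))) v)))

    decomp-⅋ : Stable V → {P₁ P₂ Q₁ Q₂ : Formula [] n} → Decomp V P₁ Q₁ → Decomp V P₂ Q₂ →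
               (∀ {m} (θ : Sub n m) {Ξ₁ Ξ₂} → V Ξ₁ (subF θ P₁) → V Ξ₂ (subF θ P₂) →
                V (Ξ₁ ++ Ξ₂) (subF θ P)) →
               Decomp V P (Q₁ ⅋ Q₂)
    decomp-⅋ {P = P} st {P₁} {P₂} {Q₁} {Q₂} f g c θ {Ξ} {Ω} k = ⅋a (f θ λ η {Ξ₁} v₁ →
      castA refl (cong (_∷ _) (sym (subF-∘ η θ Q₂))) (g (η ∘ₛ θ) λ ζ {Ξ₂} v₂ →
      let e : ∀ X → subF ζ (subF (η ∘ₛ θ) X) ≡ subF (ζ ∘ₛ (η ∘ₛ θ)) X
          e X = subF-∘ ζ (η ∘ₛ θ) X
          v = c (ζ ∘ₛ (η ∘ₛ θ))
                (castV refl (trans (cong (subF ζ) (subF-∘ η θ P₁)) (e P₁)) (st ζ v₁)) (castV refl (e P₂) v₂)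
          v′ = castV refl (trans (sym (subF-cong (∘ₛ-assoc ζ η θ) P)) (sym (subF-∘ (ζ ∘ₛ η) θ P))) v
      in exΞ (subΞ-shifts ζ η Ξ₁ Ξ₂ Ξ) (castA refl (sym (subΩ-∘ ζ η Ω)) (k (ζ ∘ₛ η) v′))))

    decomp-& : {Q₁ Q₂ : Formula [] n} → Decomp V P Q₁ → Decomp V P Q₂ → Decomp V P (Q₁ & Q₂)
    decomp-& f g θ k = &a (f θ k) (g θ k)

    Decomp-map : {P₁ : Formula [] n} →
                 (∀ {m} (θ : Sub n m) {Ξ} → V Ξ (subF θ P₁) → V Ξ (subF θ P)) →
                 Decomp V P₁ Q → Decomp V P Q
    Decomp-map {P = P} {P₁ = P₁} c f θ k =
      f θ (λ η v → k η (castV refl (sym (subF-∘ η θ P)) (c (η ∘ₛ θ) (castV refl (subF-∘ η θ P₁) v))))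

    decomp-⊥ : (∀ {m} (θ : Sub n m) → V [] (subF θ P)) → Decomp V P ⊥ₗ
    decomp-⊥ c θ k = ⊥a (Cont-now k (c θ))

    decomp-⊤ : Decomp V P ⊤ₗ
    decomp-⊤ θ k = ⊤a

    decomp-∀ : {P₁ Q₁ : Formula [] (suc n)} → Decomp V P₁ Q₁ →
               (∀ {m} (θ : Sub (suc n) m) {Ξ} → V Ξ (subF θ P₁) → V Ξ (subF (θ ∘ suc) P)) →
               Decomp V P (Forall Q₁)
    decomp-∀ {P = P} {P₁ = P₁} f c θ {Ξ} {Ω} k = ∀a (f (liftS 1 θ) λ η v →
      castA (cong (_ ++_) (sym (trans (cong (subΞ η) (renΞ≡subΞ suc Ξ)) (subΞ-∘ η (wk 1) Ξ))))
            (sym (trans (cong (subΩ η) (renΩ≡subΩ suc Ω)) (subΩ-∘ η (wk 1) Ω)))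
        (k (η ∘ suc) (castV refl (trans (subF-cong (assoc η) P) (sym (subF-∘ (η ∘ suc) θ P)))
          (c (η ∘ₛ liftS 1 θ) (castV refl (subF-∘ η (liftS 1 θ) P₁) v)))))
      where
      assoc : ∀ {l} (η : Sub _ l) → (η ∘ₛ liftS 1 θ) ∘ suc ≗ (η ∘ suc) ∘ₛ θ
      assoc η i = trans (cong (subT η) (liftS-↑ʳ 1 θ i)) (subT-∘ η (wk 1) (θ i))

    decomp-≠ : (s t : Term n) → (∀ {m} (θ : Sub n m) → subT θ s ≡ subT θ t → V [] (subF θ P)) →
               Decomp V P (s ≠ t)
    decomp-≠ {P = P} s t c θ k = ≠a (allUnifiers _ _) λ where
      (_ , η , e) → k η (castV refl (sym (subF-∘ η θ P)) (c (η ∘ₛ θ) (subT-unifier η θ {s} {t} e)))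

    decomp-natom : ∀ {a} {ts : Vec (Term n) _} →
                   (∀ {m} (θ : Sub n m) → V ((natom a (subTs θ ts) *) ∷ []) (subF θ P)) →
                   Decomp V P (natom a ts)
    decomp-natom c θ k = nfrz (Cont-now k (c θ))

  -- Functoriality

  Expansion : Formula [] n → Formula [] n → Set₁
  Expansion = Decomp Focus

  Rel : Formula [] n → Formula [] n → Set₁
  Rel P Q = Expansion P Q × Expansion Q P

  rel-subF : (σ : Sub n m) {P Q : Formula [] n} → Rel P Q → Rel (subF σ P) (subF σ Q)
  rel-subF σ {P} {Q} (f , g) = Decomp-subF {V = Focus} σ P Q f , Decomp-subF {V = Focus} σ Q P g

  rel-cast : {P P′ Q Q′ : Formula [] n} → P ≡ P′ → Q ≡ Q′ → Rel P Q → Rel P′ Q′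
  rel-cast refl refl r = r

  rel-renF : ∀ k (ρ : Ren n m) {P Q : Formula [] (k + n)} → Rel P Q →
             Rel (renF (liftR k ρ) P) (renF (liftR k ρ) Q)
  rel-renF k ρ r =
    rel-cast (sym (renF-liftR≡subF k ρ _)) (sym (renF-liftR≡subF k ρ _)) (rel-subF (liftS k (var ∘ ρ)) r)

  expansion-flip : isSync P → isAsync Q → Expansion P Q → Expansion Q P
  expansion-flip {P = P} {Q = Q} p q f θ k =
    store (isSync-subF θ P p) (Cont-now {V = Focus} k (release (isAsync-subF θ Q q)
      (f θ λ η {Ξ′} v → exΞ (++-comm (_ ∷ []) Ξ′) (focus v))))

  rel-sync : isSync P → isAsync Q → Expansion P Q → Rel P Q
  rel-sync p q f = f , expansion-flip p q f

  init-ν : ∀ k (B : Formula (k ∷ []) (k + n)) (ts : Vec (Term n) k) →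
           Focus ((ν k B ts *) ∷ []) (μ k (dual B) ts)
  init-ν k B ts = castF (cong (λ C → (ν k C ts *) ∷ []) (dual-involutive B)) refl μinit

  rel-μν : ∀ k (B : Formula (k ∷ []) (k + n)) (ts : Vec (Term n) k) →
           Rel (μ k B ts) (ν k (dual B) ts)
  rel-μν k B ts =
    rel-sync tt tt (λ θ K → νfrz (Cont-now {V = Focus} K (subFocus θ (μinit {Bd = B} {ts = ts}))))

  μs-subF : ∀ {k} (θ : Sub n m) (B : Formula (k ∷ []) (k + n)) (ts : Vec (Term n) k) →
            Focus Ξ (subF θ (unfoldμ k B ts)) → Focus Ξ (subF θ (μ k B ts))
  μs-subF θ B ts f = μs (castF refl (subF-unfoldμ _ θ B ts) f)

  coinvariance : ∀ k (B : Formula (k ∷ []) (k + n)) {X : Formula [] (k + n)} →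
                 Expansion (applyB k B (μx k B)) X → Async [] (X ∷ μx k B ∷ [])
  coinvariance {n = n} k B {X} f = exΩ (swap _ _ ↭-refl) (store tt
    (castA refl (cong (_∷ []) (subF-var X)) (f var λ η {Ξ′} v →
      exΞ (++-comm (_ ∷ []) Ξ′) (focus (μs-subF η (weakenBody k B) (vars k n)
        (castF refl (cong (subF η) (trans (subF-var (applyB k B (μx k B))) (sym (unfoldμ-vars k B)))) v))))))

  -- The coinvariant is the dual of the least fixed point.
  expansion-μν : ∀ k (B C : Formula (k ∷ []) (k + n)) (ts : Vec (Term n) k) →
                 Expansion (applyB k B (μx k B)) (applyB k C (νx k (dual B))) →
                 Expansion (μ k B ts) (ν k C ts)
  expansion-μν k B C ts f θ {Ω = Ω} K =
    νa (subF (liftS k θ) N)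
       (castA refl (cong (_∷ Ω) (trans (cong (subF θ) (sym (applyS-νx k (dual B) ts))) (subF-inst θ ts N)))
         (νfrz (Cont-now {V = Focus} K (subFocus θ (μinit {Bd = B} {ts = ts})))))
       (castCoinv θ C N (subAsync (liftS k θ)
         (castA refl (cong (λ Y → applyB k C N ∷ Y ∷ []) (sym dualN)) (coinvariance k B f))))
    where
    N = νx k (dual B)
    dualN : dual N ≡ μx k B
    dualN = trans (dual-νx k (dual B)) (cong (μx k) (dual-involutive B))

  consP : ∀ j → Formula [] (j + n) → PSub Δ [] n → PSub (j ∷ Δ) [] (j + n)
  consP j S σ pz     = weakenBody j S
  consP j S σ (ps x) = wkP j σ x

  applyB-subP : ∀ j (S : Formula [] (j + n)) (σ : PSub Δ [] n) (C : Formula (j ∷ Δ) (j + n)) →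
                applyB j (subP (psubUnderμ j σ) C) S ≡ subP (consP j S σ) C
  applyB-subP j S σ C = trans (subP-∘ _ (psubUnderμ j σ) C) (subP-cong
    (λ { pz → subF-inst-vars j (weakenBody j S)
       ; {k} (ps x) → trans (subP-renP _ ps (renF (liftR k (j ↑ʳ_)) (σ x))) (subP-id (λ ()) _) }) C)

  applyB≡subP : ∀ k (S : Formula [] (k + n)) (B : Formula (k ∷ []) (k + n)) →
                applyB k B S ≡ subP (consP k S (λ ())) B
  applyB≡subP k S B = subP-cong (λ { pz → refl ; (ps ()) }) B

  rel-consP : ∀ j {S T : Formula [] (j + n)} {σ τ : PSub Δ [] n} → Rel S T →
             (∀ {k} (x : PVar Δ k) → Rel (σ x) (τ x)) →
             ∀ {k} (x : PVar (j ∷ Δ) k) → Rel (consP j S σ x) (consP j T τ x)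
  rel-consP j r rs pz         = rel-renF j (j ↑ʳ_) r
  rel-consP j r rs {k} (ps x) = rel-renF k (j ↑ʳ_) (rs x)

  inst-head : (θ : Sub (suc n) m) → inst (θ zero ∷ []) ∘ₛ liftS 1 (θ ∘ suc) ≗ θ
  inst-head θ zero    = refl
  inst-head θ (suc i) = begin
    subT (inst (θ zero ∷ [])) (liftS 1 (θ ∘ suc) (suc i))
      ≡⟨ cong (subT (inst (θ zero ∷ []))) (liftS-↑ʳ 1 (θ ∘ suc) i) ⟩
    subT (inst (θ zero ∷ [])) (subT (wk 1) (θ (suc i)))      ≡⟨ subT-∘ _ _ (θ (suc i)) ⟩
    subT (inst (θ zero ∷ []) ∘ₛ wk 1) (θ (suc i))            ≡⟨ subT-id (λ _ → refl) (θ (suc i)) ⟩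
    θ (suc i)                                                ∎

  subF-inst-head : (θ : Sub (suc n) m) (A : Formula Δ (suc n)) →
                   subF (inst (θ zero ∷ [])) (subF (liftS 1 (θ ∘ suc)) A) ≡ subF θ A
  subF-inst-head θ A = trans (subF-∘ _ _ A) (subF-cong (inst-head θ) A)

  expansion-∃∀ : {A C : Formula [] (suc n)} → Expansion A C → Expansion (Exists A) (Forall C)
  expansion-∃∀ {A = A} f = decomp-∀ {V = Focus} {P = Exists A} f
    (λ θ v → ∃s (θ zero) (castF refl (sym (subF-inst-head θ A)) v))

  expansion-⊗⅋ : {A₁ A₂ C₁ C₂ : Formula [] n} → Expansion A₁ C₁ → Expansion A₂ C₂ →
                 Expansion (A₁ ⊗ A₂) (C₁ ⅋ C₂)
  expansion-⊗⅋ {A₁ = A₁} {A₂} f g = decomp-⅋ {V = Focus} {P = A₁ ⊗ A₂} (λ θ → subFocus θ) f g (λ θ → ⊗s)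

  expansion-⊕& : {A₁ A₂ C₁ C₂ : Formula [] n} → Expansion A₁ C₁ → Expansion A₂ C₂ →
                 Expansion (A₁ ⊕ A₂) (C₁ & C₂)
  expansion-⊕& {A₁ = A₁} {A₂} f g =
    decomp-& {V = Focus} {P = A₁ ⊕ A₂}
      (Decomp-map {V = Focus} {P = A₁ ⊕ A₂} {P₁ = A₁} (λ θ → ⊕s₁) f)
      (Decomp-map {V = Focus} {P = A₁ ⊕ A₂} {P₁ = A₂} (λ θ → ⊕s₂) g)

  rel-≐≠ : (s t : Term n) → Rel (s ≐ t) (s ≠ t)
  rel-≐≠ s t = rel-sync {P = s ≐ t} {Q = s ≠ t} tt tt
    (decomp-≠ {V = Focus} {P = s ≐ t} s t (λ θ e → castF refl (cong (subT θ s ≐_) e) (≐s (subT θ s))))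

  functoriality : (F : Formula Δ n) (σ τ : PSub Δ [] n) → (∀ {k} (x : PVar Δ k) → Rel (σ x) (τ x)) →
                  Rel (subP σ F) (subP τ (dual F))

  functoriality-μ : ∀ j (C : Formula (j ∷ Δ) (j + n)) (σ τ : PSub Δ [] n) →
                    (∀ {k} (x : PVar Δ k) → Rel (σ x) (τ x)) →
                    (S T : Formula [] (j + n)) → Rel S T →
                    Rel (applyB j (subP (psubUnderμ j σ) C) S) (applyB j (subP (psubUnderμ j τ) (dual C)) T)
  functoriality-μ j C σ τ rs S T r =
    rel-cast (sym (applyB-subP j S σ C)) (sym (applyB-subP j T τ (dual C)))
      (functoriality C (consP j S σ) (consP j T τ) (rel-consP j r rs))

  rel-μxνx : ∀ k (B : Formula (k ∷ []) (k + n)) → Rel (μx k B) (νx k (dual B))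
  rel-μxνx {n = n} k B = rel-cast refl (cong (λ C → ν k C (vars k n)) (dual-weakenBody k B))
    (rel-μν k (weakenBody k B) (vars k n))

  functoriality (atom a ts) σ τ rs  = rel-sync tt tt (decomp-natom {V = Focus} {P = atom a ts} (λ θ → ainit))
  functoriality (natom a ts) σ τ rs =
    ×-swap (rel-sync tt tt (decomp-natom {V = Focus} {P = atom a ts} (λ θ → ainit)))
  functoriality (pvar x ts) σ τ rs  = rel-subF (inst ts) (rs x)
  functoriality (A ⊗ B) σ τ rs =
    rel-sync tt tt (expansion-⊗⅋ (proj₁ (functoriality A σ τ rs)) (proj₁ (functoriality B σ τ rs)))
  functoriality (A ⅋ B) σ τ rs =
    ×-swap (rel-sync tt tt (expansion-⊗⅋ (proj₂ (functoriality A σ τ rs)) (proj₂ (functoriality B σ τ rs))))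
  functoriality (A ⊕ B) σ τ rs =
    rel-sync tt tt (expansion-⊕& (proj₁ (functoriality A σ τ rs)) (proj₁ (functoriality B σ τ rs)))
  functoriality (A & B) σ τ rs =
    ×-swap (rel-sync tt tt (expansion-⊕& (proj₂ (functoriality A σ τ rs)) (proj₂ (functoriality B σ τ rs))))
  functoriality 𝟏 σ τ rs  = rel-sync tt tt (decomp-⊥ {V = Focus} {P = 𝟏} (λ θ → 𝟏s))
  functoriality ⊥ₗ σ τ rs = ×-swap (rel-sync tt tt (decomp-⊥ {V = Focus} {P = 𝟏} (λ θ → 𝟏s)))
  functoriality 𝟎 σ τ rs  = rel-sync tt tt (decomp-⊤ {V = Focus} {P = 𝟎})
  functoriality ⊤ₗ σ τ rs = ×-swap (rel-sync tt tt (decomp-⊤ {V = Focus} {P = 𝟎}))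
  functoriality (Forall A) σ τ rs =
    ×-swap (rel-sync tt tt (expansion-∃∀ (proj₂ (functoriality A _ _ (λ {k} x → rel-renF k suc (rs x))))))
  functoriality (Exists A) σ τ rs =
    rel-sync tt tt (expansion-∃∀ (proj₁ (functoriality A _ _ (λ {k} x → rel-renF k suc (rs x)))))
  functoriality (s ≐ t) σ τ rs = rel-≐≠ s t
  functoriality (s ≠ t) σ τ rs = ×-swap (rel-≐≠ s t)
  functoriality (μ k B ts) σ τ rs = rel-sync tt tt (expansion-μν k _ _ ts
    (proj₁ (functoriality-μ k B σ τ rs _ _ (rel-μxνx k _))))
  functoriality (ν k B ts) σ τ rs = ×-swap (rel-sync tt tt (expansion-μν k _ _ ts
    (proj₂ (functoriality-μ k B σ τ rs _ _ (×-swap (rel-μxνx k _))))))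

  -- Delayed greatest fixed points

  -- Only the current asynchronous phase is traversed: at its end, focusing on the
  -- delayed formula and releasing it allows νBt to be frozen after all.
  thaw : ∀ {k} {B : Formula (k ∷ []) (k + n)} {ts : Vec (Term n) k} →
         Ξ ↭ (ν k B ts *) ∷ Ξ′ → Async Ξ Ω → Async (⟨ ν k B ts ⊕ 𝟎 ⟩ ∷ Ξ′) Ω
  thaw p (exΞ q d)  = thaw (↭-trans q p) d
  thaw p (exΩ q d)  = exΩ q (thaw p d)
  thaw p (⅋a d)     = ⅋a (thaw p d)
  thaw p (⊥a d)     = ⊥a (thaw p d)
  thaw p (&a d e)   = &a (thaw p d) (thaw p e)
  thaw p ⊤a         = ⊤a
  thaw p (∀a d)     = ∀a (thaw (map⁺ (renI suc) p) d)
  thaw p (≠a c ds)  = ≠a c (λ u → thaw (map⁺ (subI (uni c u)) p) (ds u))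
  thaw p (νa S d e) = νa S (thaw p d) e
  thaw p (νfrz d)   = νfrz (exΞ (swap _ _ ↭-refl) (thaw (↭-trans (prep _ p) (swap _ _ ↭-refl)) d))
  thaw p (nfrz d)   = nfrz (exΞ (swap _ _ ↭-refl) (thaw (↭-trans (prep _ p) (swap _ _ ↭-refl)) d))
  thaw p (store s d) =
    store s (exΞ (swap _ _ ↭-refl) (thaw (↭-trans (prep _ p) (swap _ _ ↭-refl)) d))
  thaw p (focus f)  = focus (⊕s₁ (release tt (νfrz (exΞ p (focus f)))))

  rel-delay : ∀ k (B : Formula (k ∷ []) (k + n)) (ts : Vec (Term n) k) →
              Rel (ν k B ts ⊕ 𝟎) (μ k (dual B) ts)
  rel-delay k B ts =
    (λ θ K → store tt (Cont-now {V = Focus} K (⊕s₁ (release tt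
      (νfrz (exΞ (swap _ _ ↭-refl) (focus (subFocus θ (init-ν k B ts)))))))))
    , (λ θ K → store tt (thaw ↭-refl (Cont-now {V = Focus} K (subFocus θ (init-ν k B ts)))))

  delay-coinvariant : ∀ k (B : Formula (k ∷ []) (k + n)) →
                      Async [] (applyB k B (νx k B ⊕ 𝟎) ∷ dual (νx k B ⊕ 𝟎) ∷ [])
  delay-coinvariant {n = n} k B = exΩ (swap _ _ ↭-refl) (&a
    (castA refl (cong (_∷ applyB k B (νx k B ⊕ 𝟎) ∷ []) (sym (dual-νx k B))) (exΩ (swap _ _ ↭-refl)
      (coinvariance k (dual B) (proj₂ (rel-cast (sym (applyB≡subP k _ B)) (sym (applyB≡subP k _ (dual B)))
        (functoriality B (consP k (νx k B ⊕ 𝟎) (λ ())) (consP k (μx k (dual B)) (λ ()))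
          (rel-consP k (rel-cast refl (dual-νx k B) (rel-delay k (weakenBody k B) (vars k n))) λ ())))))))
    ⊤a)

  νdelay : ∀ {k} {B : Formula (k ∷ []) (k + n)} {ts : Vec (Term n) k} →
           Async (⟨ ν k B ts ⊕ 𝟎 ⟩ ∷ Ξ) Ω → Async Ξ (ν k B ts ∷ Ω)
  νdelay {Ω = Ω} {k = k} {B} {ts} d = νa (νx k B ⊕ 𝟎)
    (castA refl (cong (λ C → (C ⊕ 𝟎) ∷ Ω) (sym (applyS-νx k B ts))) (store tt d)) (delay-coinvariant k B)

  -- The asynchronous phase

  -- Leaf Φ A: some branch of the asynchronous phase on A, in which every greatest
  -- fixed point is delayed, ends with the items Φ.
  data Leaf {n} : List (Item n) → Formula [] n → Set₁ where
    sync  : isSync P → Leaf (⟨ P ⟩ ∷ []) P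
    natom : ∀ {a ts} → Leaf ((natom a ts *) ∷ []) (natom a ts)
    ν     : ∀ {k B ts} → Leaf (⟨ ν k B ts ⊕ 𝟎 ⟩ ∷ []) (ν k B ts)
    par   : Leaf Φ A → Leaf Φ′ B → Leaf (Φ ++ Φ′) (A ⅋ B)
    bot   : Leaf [] ⊥ₗ
    with₁ : Leaf Φ A → Leaf Φ (A & B)
    with₂ : Leaf Φ B → Leaf Φ (A & B)
    all   : ∀ {A} (t : Term n) → Leaf Φ (subF (inst (t ∷ [])) A) → Leaf Φ (Forall A)
    neq   : ∀ {s t} → s ≡ t → Leaf [] (s ≠ t)

  castL : Φ ≡ Φ′ → A ≡ B → Leaf Φ A → Leaf Φ′ B
  castL refl refl l = l

  leaf-subF : Stable Leaf
  leaf-subF θ (sync p)            = sync (isSync-subF θ _ p)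
  leaf-subF θ natom               = natom
  leaf-subF θ ν                   = ν
  leaf-subF θ (par {Φ = Φ} l l′) =
    castL (sym (map-++ (subI θ) Φ _)) refl (par (leaf-subF θ l) (leaf-subF θ l′))
  leaf-subF θ bot                 = bot
  leaf-subF θ (with₁ l)           = with₁ (leaf-subF θ l)
  leaf-subF θ (with₂ l)           = with₂ (leaf-subF θ l)
  leaf-subF θ (all {A = A} t l) =
    all (subT θ t) (castL refl (subF-inst θ (t ∷ []) A) (leaf-subF θ l))
  leaf-subF θ (neq e)             = neq (cong (subT θ) e)

  leaf-isSync : isSync P → Leaf Φ P → Φ ≡ ⟨ P ⟩ ∷ []
  leaf-isSync p (sync _) = refl

  decomp-sync : isSync P → Decomp Leaf P P
  decomp-sync {P = P} p θ K = store (isSync-subF θ P p) (Cont-now {V = Leaf} K (sync (isSync-subF θ P p)))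

  decomp-leaf : (Q : Formula [] n) → Decomp Leaf Q Q
  decomp-leaf (natom a ts) = decomp-natom {V = Leaf} {P = natom a ts} (λ θ → natom)
  decomp-leaf (A ⅋ B) =
    decomp-⅋ {V = Leaf} {P = A ⅋ B} leaf-subF (decomp-leaf A) (decomp-leaf B) (λ θ → par)
  decomp-leaf (A & B) = decomp-& {V = Leaf} {P = A & B}
    (Decomp-map {V = Leaf} {P = A & B} {P₁ = A} (λ θ → with₁) (decomp-leaf A))
    (Decomp-map {V = Leaf} {P = A & B} {P₁ = B} (λ θ → with₂) (decomp-leaf B))
  decomp-leaf ⊥ₗ = decomp-⊥ {V = Leaf} {P = ⊥ₗ} (λ θ → bot)
  decomp-leaf ⊤ₗ = decomp-⊤ {V = Leaf} {P = ⊤ₗ}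
  decomp-leaf (Forall A) = decomp-∀ {V = Leaf} {P = Forall A} (decomp-leaf A)
    (λ θ l → all (θ zero) (castL refl (sym (subF-inst-head θ A)) l))
  decomp-leaf (s ≠ t) = decomp-≠ {V = Leaf} {P = s ≠ t} s t (λ θ → neq)
  decomp-leaf (ν k B ts) θ K = νdelay (Cont-now {V = Leaf} K ν)
  decomp-leaf P@(atom _ _) = decomp-sync {P = P} tt
  decomp-leaf P@(_ ⊗ _) = decomp-sync {P = P} tt
  decomp-leaf P@(_ ⊕ _) = decomp-sync {P = P} tt
  decomp-leaf P@𝟏 = decomp-sync {P = P} tt
  decomp-leaf P@𝟎 = decomp-sync {P = P} tt
  decomp-leaf P@(Exists _) = decomp-sync {P = P} tt
  decomp-leaf P@(_ ≐ _) = decomp-sync {P = P} tt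
  decomp-leaf P@(μ _ _ _) = decomp-sync {P = P} tt

  infixr 5 _∷_
  data Leaves {n} : List (Item n) → List (Formula [] n) → Set₁ where
    []  : Leaves [] []
    _∷_ : Leaf Φ A → Leaves Φ′ Ω → Leaves (Φ ++ Φ′) (A ∷ Ω)

  castLs : Φ ≡ Φ′ → Ω ≡ Ω′ → Leaves Φ Ω → Leaves Φ′ Ω′
  castLs refl refl l = l

  leaves-subF : (θ : Sub n m) → Leaves Φ Ω → Leaves (subΞ θ Φ) (subΩ θ Ω)
  leaves-subF θ []                 = []
  leaves-subF θ (_∷_ {Φ = Φ} l ls) =
    castLs (sym (map-++ (subI θ) Φ _)) refl (leaf-subF θ l ∷ leaves-subF θ ls)

  leaves-↭ : Ω ↭ Ω′ → Leaves Φ Ω → ∃ λ Φ′ → Leaves Φ′ Ω′ × Φ ↭ Φ′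
  leaves-↭ refl ls = _ , ls , ↭-refl
  leaves-↭ (prep A p) (_∷_ {Φ = Φ} l ls) =
    let (_ , ls′ , q) = leaves-↭ p ls in _ , l ∷ ls′ , ++⁺ˡ Φ q
  leaves-↭ (swap A B p) (_∷_ {Φ = Φ} l (_∷_ {Φ = Φ′} l′ ls)) = let (_ , ls′ , q) = leaves-↭ p ls in
    _ , l′ ∷ l ∷ ls′ , ↭-trans (shifts Φ Φ′) (++⁺ˡ Φ′ (++⁺ˡ Φ q))
  leaves-↭ (Perm.trans p q) ls =
    let (_ , ls′ , r)  = leaves-↭ p ls
        (_ , ls″ , r′) = leaves-↭ q ls′
    in _ , ls″ , ↭-trans r r′

  leaves-++ : ∀ (Γ : List (Formula [] n)) {Γ′ Φ} → Leaves Φ (Γ ++ Γ′) →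
              ∃ λ Φ₁ → ∃ λ Φ₂ → Leaves Φ₁ Γ × Leaves Φ₂ Γ′ × Φ₁ ++ Φ₂ ≡ Φ
  leaves-++ []      ls = _ , _ , [] , ls , refl
  leaves-++ (A ∷ Γ) (_∷_ {Φ = Φ} l ls) = let (_ , _ , ls₁ , ls₂ , e) = leaves-++ Γ ls in
    _ , _ , l ∷ ls₁ , ls₂ , trans (++-assoc Φ _ _) (cong (Φ ++_) e)

  Inverted : List (Item n) → List (Formula [] n) → Set₁
  Inverted {n} Ξ Ω = ∀ {m} (θ : Sub n m) {Φ} → Leaves Φ (subΩ θ Ω) → Async (Φ ++ subΞ θ Ξ) []

  isolate : Inverted Ξ (A ∷ Ω) → (θ : Sub n m) → Leaves Φ (subΩ θ Ω) →
            Async (Φ ++ subΞ θ Ξ) (subF θ A ∷ [])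
  isolate {Ξ = Ξ} {A = A} {Ω = Ω} {Φ = Φ} f θ ls = decomp-leaf A θ λ η {Ξ′} l →
    castA (trans (++-assoc Ξ′ _ _) (cong (Ξ′ ++_)
            (trans (cong (subΞ η Φ ++_) (sym (subΞ-∘ η θ Ξ))) (sym (map-++ (subI η) Φ (subΞ θ Ξ)))))) refl
      (f (η ∘ₛ θ) (castL refl (subF-∘ η θ A) l ∷ castLs refl (subΩ-∘ η θ Ω) (leaves-subF η ls)))

  -- A coinduction is postponed to the end of the phase, where its delayed item is
  -- focused on once all other formulas have been decomposed.
  invert : Async Ξ Ω → Inverted Ξ Ω
  invert (exΞ p d) θ {Φ} ls = exΞ (++⁺ˡ Φ (map⁺ (subI θ) p)) (invert d θ ls)
  invert {Ξ = Ξ} (exΩ p d) θ ls = let (_ , ls′ , q) = leaves-↭ (↭-sym (map⁺ (subF θ) p)) ls in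
    exΞ (++⁺ʳ (subΞ θ Ξ) (↭-sym q)) (invert d θ ls′)
  invert {Ξ = Ξ} (⅋a d) θ (par {Φ = Φ} {Φ′ = Φ′} l l′ ∷ ls) =
    castA (cong (_++ subΞ θ Ξ) (sym (++-assoc Φ Φ′ _))) refl (invert d θ (l ∷ l′ ∷ ls))
  invert (⊥a d) θ (bot ∷ ls) = invert d θ ls
  invert (&a d e) θ (with₁ l ∷ ls) = invert d θ (l ∷ ls)
  invert (&a d e) θ (with₂ l ∷ ls) = invert e θ (l ∷ ls)
  invert ⊤a θ (sync () ∷ ls)
  invert (∀a {Ξ = Ξ} {Ω = Ω} {A = A} d) θ (all t l ∷ ls) =
    castA (cong (_ ++_) (trans (cong (subΞ θ′) (renΞ≡subΞ suc Ξ)) (eqΞ Ξ))) refl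
      (invert d θ′ (castL refl (trans (subF-∘ _ _ A) (subF-cong eqA A)) l
        ∷ castLs refl (sym (trans (cong (subΩ θ′) (renΩ≡subΩ suc Ω)) (eqΩ Ω))) ls))
    where
    θ′ : Sub _ _
    θ′ zero    = t
    θ′ (suc i) = θ i
    eqA : inst (t ∷ []) ∘ₛ liftS 1 θ ≗ θ′
    eqA = inst-head θ′
    eqΞ : ∀ Ξ → subΞ θ′ (subΞ (wk 1) Ξ) ≡ subΞ θ Ξ
    eqΞ = subΞ-∘ θ′ (wk 1)
    eqΩ : ∀ Ω → subΩ θ′ (subΩ (wk 1) Ω) ≡ subΩ θ Ω
    eqΩ = subΩ-∘ θ′ (wk 1)
  invert (≠a {Ξ = Ξ} {Ω = Ω} c ds) θ (neq e ∷ ls) = let (u , ρ , q) = complete c θ e in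
    castA (cong (_ ++_) (trans (subΞ-∘ ρ (uni c u) Ξ) (subΞ-cong q Ξ))) refl
      (invert (ds u) ρ (castLs refl (sym (trans (subΩ-∘ ρ (uni c u) Ω) (subΩ-cong q Ω))) ls))
  invert (νa {ts = ts} {Bd = B} S d e) θ (ν ∷ ls) = focus (⊕s₁ (release tt
    (νa (subF (liftS _ θ) S) (castA refl (cong (_∷ []) (subF-inst θ ts S)) (isolate (invert d) θ ls))
        (castCoinv θ B S (subAsync (liftS _ θ) e)))))
  invert {Ξ = Ξ} (νfrz d) θ (_∷_ {Φ′ = Φ} ν ls) =
    focus (⊕s₁ (release tt (νfrz (exΞ (shift _ Φ (subΞ θ Ξ)) (invert d θ ls)))))
  invert {Ξ = Ξ} (nfrz d) θ (_∷_ {Φ′ = Φ} natom ls) = exΞ (shift _ Φ (subΞ θ Ξ)) (invert d θ ls)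
  invert {Ξ = Ξ} (store {P = P} p d) θ (_∷_ {Φ′ = Φ} l ls) with refl ← leaf-isSync (isSync-subF θ P p) l =
    exΞ (shift _ Φ (subΞ θ Ξ)) (invert d θ ls)
  invert (focus f) θ [] = focus (subFocus θ f)

  rebuild-subF : (Γ : List (Formula [] n)) (θ : Sub n m) → Inverted Ξ (subΩ θ Γ) →
                 Async Ξ (subΩ θ Γ)
  rebuild-subF {Ξ = Ξ} [] θ k = castA (subΞ-var Ξ) refl (k var [])
  rebuild-subF {Ξ = Ξ} (A ∷ Γ) θ k = decomp-leaf A θ λ η {Ξ′} l →
    castA refl (sym (subΩ-∘ η θ Γ)) (rebuild-subF Γ (η ∘ₛ θ) λ ζ {Φ} ls →
      exΞ (subΞ-shifts ζ η Ξ′ Φ Ξ) (k (ζ ∘ₛ η)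
        (castL refl (subF-∘ ζ η (subF θ A)) (leaf-subF ζ l)
         ∷ castLs refl (trans (cong (subΩ ζ) (sym (subΩ-∘ η θ Γ))) (subΩ-∘ ζ η (subΩ θ Γ))) ls)))

  rebuild : Inverted Ξ Γ → Async Ξ Γ
  rebuild {Ξ = Ξ} {Γ = Γ} k = castA refl (subΩ-var Γ)
    (rebuild-subF Γ var (subst (Inverted Ξ) (sym (subΩ-var Γ)) k))

  -- Synchronous rules

  ∈⇒↭ : ∀ {a} {X : Set a} {x : X} {xs} → x ∈ xs → ∃ λ ys → xs ↭ x ∷ ys
  ∈⇒↭ x∈xs with (ys , zs , refl) ← ∈-∃++ x∈xs = ys ++ zs , shift _ ys zs

  ∷↭∷-cases : ∀ {a} {X : Set a} {x y : X} {xs ys} → y ∷ ys ↭ x ∷ xs →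
              (y ≡ x × ys ↭ xs) ⊎ (∃ λ zs → ys ↭ x ∷ zs × y ∷ zs ↭ xs)
  ∷↭∷-cases p with ∈-resp-↭ (↭-sym p) (here refl)
  ... | here refl = inj₁ (refl , drop-∷ p)
  ... | there x∈ys = let (zs , q) = ∈⇒↭ x∈ys in
    inj₂ (zs , q , drop-∷ (↭-trans (↭-sym (↭-trans (prep _ q) (swap _ _ ↭-refl))) p))

  ++↭∷-cases : ∀ {a} {X : Set a} {x : X} (xs ys : List X) {zs} → xs ++ ys ↭ x ∷ zs →
               (∃ λ xs′ → xs ↭ x ∷ xs′ × xs′ ++ ys ↭ zs) ⊎ (∃ λ ys′ → ys ↭ x ∷ ys′ × xs ++ ys′ ↭ zs)
  ++↭∷-cases xs ys p with ∈-++⁻ xs (∈-resp-↭ (↭-sym p) (here refl))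
  ... | inj₁ x∈xs = let (xs′ , q) = ∈⇒↭ x∈xs in
    inj₁ (xs′ , q , drop-∷ (↭-trans (↭-sym (++⁺ʳ ys q)) p))
  ... | inj₂ x∈ys = let (ys′ , q) = ∈⇒↭ x∈ys in
    inj₂ (ys′ , q , drop-∷ (↭-trans (↭-sym (↭-trans (++⁺ˡ xs q) (shift _ xs ys′))) p))

  SyncCont : Formula [] n → List (Item n) → Set₁
  SyncCont A Φ = Cont Focus A Φ []

  SyncCont-subF : (σ : Sub n m) {A : Formula [] n} → SyncCont A Φ → SyncCont (subF σ A) (subΞ σ Φ)
  SyncCont-subF {Φ = Φ} σ {A} k η {Ξ′} f =
    castA (cong (Ξ′ ++_) (sym (subΞ-∘ η σ Φ))) refl (k (η ∘ₛ σ) (castF refl (subF-∘ η σ A) f))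

  mutual
    replace-Async : SyncCont A Φ → Ξ ↭ ⟨ A ⟩ ∷ Ξ′ → Async Ξ Ω → Async (Ξ′ ++ Φ) Ω
    replace-Async k p (exΞ q d)   = replace-Async k (↭-trans q p) d
    replace-Async k p (exΩ q d)   = exΩ q (replace-Async k p d)
    replace-Async k p (⅋a d)      = ⅋a (replace-Async k p d)
    replace-Async k p (⊥a d)      = ⊥a (replace-Async k p d)
    replace-Async k p (&a d e)    = &a (replace-Async k p d) (replace-Async k p e)
    replace-Async k p ⊤a          = ⊤a
    replace-Async {A = A} {Φ = Φ} {Ξ′ = Ξ′} k p (∀a d) =
      ∀a (castA (sym (map-++ (renI suc) Ξ′ Φ)) refl
        (replace-Async (subst₂ SyncCont (sym (renF≡subF suc A)) (sym (renΞ≡subΞ suc Φ))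
                         (SyncCont-subF (wk 1) {A} k))
                       (map⁺ (renI suc) p) d))
    replace-Async {A = A} {Φ = Φ} {Ξ′ = Ξ′} k p (≠a c ds) = ≠a c λ u →
      castA (sym (map-++ (subI (uni c u)) Ξ′ Φ)) refl
        (replace-Async (SyncCont-subF (uni c u) {A} k) (map⁺ (subI (uni c u)) p) (ds u))
    replace-Async k p (νa S d e)  = νa S (replace-Async k p d) e
    replace-Async k p (νfrz d)    = νfrz (replace-Async k (↭-trans (prep _ p) (swap _ _ ↭-refl)) d)
    replace-Async k p (nfrz d)    = nfrz (replace-Async k (↭-trans (prep _ p) (swap _ _ ↭-refl)) d)
    replace-Async k p (store s d) =
      store s (replace-Async k (↭-trans (prep _ p) (swap _ _ ↭-refl)) d)
    replace-Async {Φ = Φ} k p (focus f) with ∷↭∷-cases p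
    ... | inj₁ (refl , q)   = exΞ (++⁺ʳ Φ q) (Cont-now {V = Focus} k f)
    ... | inj₂ (_ , q , r)  = exΞ (++⁺ʳ Φ r) (focus (replace-Focus k q f))

    replace-Focus : SyncCont A Φ → Ξ ↭ ⟨ A ⟩ ∷ Ξ′ → Focus Ξ P → Focus (Ξ′ ++ Φ) P
    replace-Focus k p (exF q f) = replace-Focus k (↭-trans q p) f
    replace-Focus {Φ = Φ} k p (⊗s {Ξ = Ξ₁} {Ξ' = Ξ₂} f g) with ++↭∷-cases Ξ₁ Ξ₂ p
    ... | inj₁ (Ξ₁′ , q , r) = exF
      (↭-trans (↭-trans (↭-reflexive (++-assoc Ξ₁′ Φ Ξ₂)) (↭-trans (++⁺ˡ Ξ₁′ (++-comm Φ Ξ₂))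
        (↭-reflexive (sym (++-assoc Ξ₁′ Ξ₂ Φ))))) (++⁺ʳ Φ r))
      (⊗s (replace-Focus k q f) g)
    ... | inj₂ (Ξ₂′ , q , r) = exF
      (↭-trans (↭-reflexive (sym (++-assoc Ξ₁ Ξ₂′ Φ))) (++⁺ʳ Φ r)) (⊗s f (replace-Focus k q g))
    replace-Focus k p 𝟏s        = ⊥-elim (¬x∷xs↭[] (↭-sym p))
    replace-Focus k p (⊕s₁ f)   = ⊕s₁ (replace-Focus k p f)
    replace-Focus k p (⊕s₂ f)   = ⊕s₂ (replace-Focus k p f)
    replace-Focus k p (∃s t f)  = ∃s t (replace-Focus k p f)
    replace-Focus k p (≐s t)    = ⊥-elim (¬x∷xs↭[] (↭-sym p))
    replace-Focus k p (μs f)    = μs (replace-Focus k p f)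
    replace-Focus k p μinit     with () ← ↭-singleton-inv (↭-sym p)
    replace-Focus k p ainit     with () ← ↭-singleton-inv (↭-sym p)
    replace-Focus k p (release a d) = release a (replace-Async k p d)

  polarity : (A : Formula [] n) → isSync A ⊎ isAsync A
  polarity (atom _ _)  = inj₁ tt
  polarity (natom _ _) = inj₂ tt
  polarity (_ ⊗ _)     = inj₁ tt
  polarity (_ ⅋ _)     = inj₂ tt
  polarity (_ ⊕ _)     = inj₁ tt
  polarity (_ & _)     = inj₂ tt
  polarity 𝟏           = inj₁ tt
  polarity ⊥ₗ          = inj₂ tt
  polarity 𝟎           = inj₁ tt
  polarity ⊤ₗ          = inj₂ tt
  polarity (Forall _)  = inj₂ tt
  polarity (Exists _)  = inj₁ tt
  polarity (_ ≐ _)     = inj₁ tt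
  polarity (_ ≠ _)     = inj₂ tt
  polarity (μ _ _ _)   = inj₁ tt
  polarity (ν _ _ _)   = inj₂ tt

  bindFocus : Async Ξ (A ∷ []) → SyncCont A Φ → Async (Ξ ++ Φ) []
  bindFocus {Ξ = Ξ} {A = A} d k with polarity A
  ... | inj₁ p = replace-Async k ↭-refl
    (castA (cong₂ (λ B Θ → ⟨ B ⟩ ∷ Θ) (subF-var A) (subΞ-var Ξ)) refl
      (invert d var (sync (isSync-subF var A p) ∷ [])))
  ... | inj₂ q = Cont-now {V = Focus} k (release q d)

  isolate₀ : Async [] (A ∷ Ω) → (θ : Sub n m) → Leaves Φ (subΩ θ Ω) → Async Φ (subF θ A ∷ [])
  isolate₀ {Φ = Φ} d θ ls = castA (++-identityʳ Φ) refl (isolate (invert d) θ ls)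

  sync-unary : isSync P → (∀ {m} (θ : Sub n m) {Ξ} → Focus Ξ (subF θ A) → Focus Ξ (subF θ P)) →
               Async [] (A ∷ Γ) → Async [] (P ∷ Γ)
  sync-unary {P = P} {A = A} p c d = store p (rebuild λ θ ls → bindFocus (isolate₀ d θ ls) λ η {Ξ′} f →
    exΞ (++-comm (_ ∷ []) Ξ′) (focus (castF refl (sym (subF-∘ η θ P))
      (c (η ∘ₛ θ) (castF refl (subF-∘ η θ A) f)))))

  sync-⊗ : Async [] (A ∷ Γ) → Async [] (B ∷ Γ′) → Async [] (A ⊗ B ∷ Γ ++ Γ′)
  sync-⊗ {A = A} {Γ = Γ} {B = B} {Γ′ = Γ′} d e = store tt (rebuild λ θ ls →
    let (Φ₁ , Φ₂ , ls₁ , ls₂ , eq) = leaves-++ (subΩ θ Γ) (castLs refl (map-++ (subF θ) Γ Γ′) ls)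
        T = ⟨ subF θ (A ⊗ B) ⟩
    in castA (trans (sym (++-assoc Φ₁ Φ₂ (T ∷ []))) (cong (_++ T ∷ []) eq)) refl
      (bindFocus (isolate₀ d θ ls₁) λ η {Ξ₁} f →
        exΞ (↭-trans (shifts (subΞ η Φ₂) Ξ₁) (↭-reflexive (cong (Ξ₁ ++_) (sym (map-++ (subI η) Φ₂ (T ∷ []))))))
        (bindFocus (subAsync η (isolate₀ e θ ls₂)) λ ζ {Ξ₂} g →
          exΞ (↭-trans (++-comm (_ ∷ []) (subΞ ζ Ξ₁ ++ Ξ₂))
              (↭-trans (↭-reflexive (++-assoc (subΞ ζ Ξ₁) Ξ₂ _)) (↭-trans (shifts (subΞ ζ Ξ₁) Ξ₂)
                (↭-reflexive (cong (Ξ₂ ++_) (sym (map-++ (subI ζ) Ξ₁ _)))))))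
            (focus (⊗s (subFocus ζ f) g)))))

  -- Completeness

  dual-isAsync : (P : Formula Δ n) → isAsync P → isSync (dual P)
  dual-isAsync (natom _ _) p = tt
  dual-isAsync (_ ⅋ _)     p = tt
  dual-isAsync (_ & _)     p = tt
  dual-isAsync ⊥ₗ          p = tt
  dual-isAsync ⊤ₗ          p = tt
  dual-isAsync (Forall _)  p = tt
  dual-isAsync (_ ≠ _)     p = tt
  dual-isAsync (ν _ _ _)   p = tt

  rel-dual : (P : Formula [] n) → Rel P (dual P)
  rel-dual P = rel-cast (subP-id (λ ()) P) (subP-id (λ ()) (dual P)) (functoriality P (λ ()) (λ ()) (λ ()))

  identity-sync : isSync P → Expansion P Q → Async [] (P ∷ Q ∷ [])
  identity-sync {Q = Q} p f = store p (castA refl (cong (_∷ []) (subF-var Q)) (f var λ η {Ξ′} v →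
    exΞ (++-comm (_ ∷ []) Ξ′) (focus (castF refl (cong (subF η) (subF-var _)) v))))

  identity : (P : Formula [] n) → Async [] (P ∷ dual P ∷ [])
  identity P with polarity P
  ... | inj₁ p = identity-sync p (proj₁ (rel-dual P))
  ... | inj₂ p = exΩ (swap _ _ ↭-refl) (identity-sync (dual-isAsync P p) (proj₂ (rel-dual P)))

  completeness : (d : Deriv Γ) → CutFree d → Async [] Γ
  completeness (ex p d) c           = exΩ p (completeness d c)
  completeness (init P) c           = identity P
  completeness (⊗r d e) (c , c′)    = sync-⊗ (completeness d c) (completeness e c′)
  completeness (⅋r d) c             = ⅋a (completeness d c)
  completeness (⊕r₁ {A = A} {B = B} d) c =
    sync-unary {P = A ⊕ B} {A = A} tt (λ θ → ⊕s₁) (completeness d c)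
  completeness (⊕r₂ {B = B} {A = A} d) c =
    sync-unary {P = A ⊕ B} {A = B} tt (λ θ → ⊕s₂) (completeness d c)
  completeness (&r d e) (c , c′)    = &a (completeness d c) (completeness e c′)
  completeness 𝟏r c                 = store tt (focus 𝟏s)
  completeness (⊥r d) c             = ⊥a (completeness d c)
  completeness ⊤r c                 = ⊤a
  completeness (∀r d) c             = ∀a (completeness d c)
  completeness (∃r {A = A} t d) c   = sync-unary {P = Exists A} tt
    (λ θ f → ∃s (subT θ t) (castF refl (subF-inst θ (t ∷ []) A) f)) (completeness d c)
  completeness (≐r t) c             = store tt (focus (≐s t))
  completeness (≠r u ds) c          = ≠a u (λ i → completeness (ds i) (c i))
  completeness (μr {Bd = B} {ts = ts} d) c =
    sync-unary {P = μ _ B ts} tt (λ θ → μs-subF θ B ts) (completeness d c)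
  completeness (νr S d e) (c , c′)  = νa S (completeness d c) (completeness e c′)

  -- Soundness

  forget : Item n → Formula [] n
  forget ⟨ P ⟩ = P
  forget (P *) = P

  forget-natural : {f : Formula [] n → Formula [] m} {g : Item n → Item m} →
                   (∀ i → forget (g i) ≡ f (forget i)) → ∀ Ω Ξ →
                   map f Ω ++ map forget (map g Ξ) ≡ map f (Ω ++ map forget Ξ)
  forget-natural {f = f} e Ω Ξ = trans
    (cong (map f Ω ++_) (trans (sym (map-∘ Ξ)) (trans (map-cong e Ξ) (map-∘ Ξ))))
    (sym (map-++ f Ω (map forget Ξ)))

  mutual
    soundAsync : Async Ξ Ω → Deriv (Ω ++ map forget Ξ)
    soundAsync {Ω = Ω} (exΞ p d) = ex (++⁺ˡ Ω (map⁺ forget p)) (soundAsync d)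
    soundAsync {Ξ = Ξ} (exΩ p d) = ex (++⁺ʳ (map forget Ξ) p) (soundAsync d)
    soundAsync (⅋a d)      = ⅋r (soundAsync d)
    soundAsync (⊥a d)      = ⊥r (soundAsync d)
    soundAsync (&a d e)    = &r (soundAsync d) (soundAsync e)
    soundAsync ⊤a          = ⊤r
    soundAsync (∀a {Ξ = Ξ} {Ω = Ω} d) = ∀r (subst Deriv
      (cong (_ ∷_) (forget-natural (λ { ⟨ _ ⟩ → refl ; (_ *) → refl }) Ω Ξ)) (soundAsync d))
    soundAsync (≠a {Ξ = Ξ} {Ω = Ω} c ds) = ≠r c (λ u → subst Deriv
      (forget-natural (λ { ⟨ _ ⟩ → refl ; (_ *) → refl }) Ω Ξ) (soundAsync (ds u)))
    soundAsync (νa S d e)  = νr S (soundAsync d) (soundAsync e)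
    soundAsync {Ω = _ ∷ Ω} (νfrz d)    = ex (shift _ Ω _) (soundAsync d)
    soundAsync {Ω = _ ∷ Ω} (nfrz d)    = ex (shift _ Ω _) (soundAsync d)
    soundAsync {Ω = _ ∷ Ω} (store _ d) = ex (shift _ Ω _) (soundAsync d)
    soundAsync (focus f)   = soundFocus f

    soundFocus : Focus Ξ P → Deriv (P ∷ map forget Ξ)
    soundFocus (exF p f)     = ex (prep _ (map⁺ forget p)) (soundFocus f)
    soundFocus (⊗s {Ξ = Ξ} {Ξ' = Ξ′} f g) = subst Deriv
      (cong (_ ∷_) (sym (map-++ forget Ξ Ξ′))) (⊗r (soundFocus f) (soundFocus g))
    soundFocus 𝟏s            = 𝟏r
    soundFocus (⊕s₁ f)       = ⊕r₁ (soundFocus f)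
    soundFocus (⊕s₂ f)       = ⊕r₂ (soundFocus f)
    soundFocus (∃s t f)      = ∃r t (soundFocus f)
    soundFocus (≐s t)        = ≐r t
    soundFocus (μs f)        = μr (soundFocus f)
    soundFocus μinit         = init _
    soundFocus ainit         = init _
    soundFocus (release _ d) = soundAsync d

  soundness : Async [] Γ → Deriv Γ
  soundness {Γ = Γ} d = subst Deriv (++-identityʳ Γ) (soundAsync d)

open import Defs

mainTheorem5 : (𝕊 : Sig) {n : ℕ} (Γ : List (Formula 𝕊 [] n)) →
    (Async 𝕊 [] Γ → Deriv 𝕊 Γ)
    × ((d : Deriv 𝕊 Γ) → QuasiFinite 𝕊 d → Async 𝕊 [] Γ)
mainTheorem5 𝕊 Γ = Focalization.soundness 𝕊 , λ d q → Focalization.completeness 𝕊 d (proj₁ q)
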